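{- Let $d\ge e\ge 0$ be integers and let $\alpha_0,\dots,\alpha_d,\beta_0,\dots,\beta_e$ be distinct positive integers with $$\alpha_d \mid \alpha_{d-1} \mid \cdots \mid \alpha_e \mid \beta_e \mid \alpha_{e-1} \mid \beta_{e-1} \mid \cdots \mid \alpha_0 \mid \beta_0 .$$ Let $$\Delta_1 = \operatorname{conv}\left\{\left(\tfrac{1}{\alpha_0},0,\dots,0\right),\left(0,\tfrac{1}{\alpha_1},0,\dots,0\right),\dots,\left(0,\dots,0,\tfrac{1}{\alpha_d}\right)\right\}\subset\mathbb{R}^{d+1},$$ $$\Delta_2 = \operatorname{conv}\left\{\left(\tfrac{1}{\beta_0},0,\dots,0\right),\left(0,\tfrac{1}{\beta_1},0,\dots,0\right),\dots,\left(0,\dots,0,\tfrac{1}{\beta_e}\right)\right\}\subset\mathbb{R}^{e+1}.$$ Write $L_{\Delta_1}(k)=\sum_{j=0}^d a_j(k)k^j$ and $L_{\Delta_2}(k)=\sum_{j=0}^e b_j(k)k^j$ for their Ehrhart quasi-polynomials, and let $\hat\alpha_j$ and $\hat\beta_j$ denote the minimum periods of $a_j$ and $b_j$, respectively. Let $C(k)=\sum_{m=0}^k L_{\Delta_1}(k-m)\,L_{\Delta_2}(m)$ be the convolution of $L_{\Delta_1}$ and $L_{\Delta_2}$, write $C(k)=\sum_{j=0}^{d+e+1}c_j(k)k^j$ with $c_j$ periodic, and let $\gamma_j$ be the minimum period of $c_j$. Put $g_{ -1}=1$ and, for $0\le j\le d+e$, $$g_j=\operatorname{lcm}\{\gcd(\hat\alpha_i,\hat\beta_{j-i})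 : 0\le i\le d,\ 0\le j-i\le e\}.$$ Then for every $j$ with $-1\le j\le d+e$, $$\gamma_{j+1} = \operatorname{lcm}\{\hat\alpha_{j+1},\dots,\hat\alpha_d,\ \hat\beta_{j+1},\dots,\hat\beta_e,\ g_j\}.$$
   Context: A quasi-polynomial is a function on $\mathbb{Z}$ of the form $q(k) = c_d(k)k^d + \dots + c_0(k)$ where $c_0,\dots,c_d$ are periodic functions of $k\in\mathbb{Z}$, called the coefficient functions of $q$ (they are uniquely determined by $q$, even by its values at positive integers). The minimum period of a periodic function $c$ on $\mathbb{Z}$ is the smallest positive integer $p$ with $c(k+p)=c(k)$ for all $k\in\mathbb{Z}$. For a rational polytope $\mathcal{P}\subset\mathbb{R}^n$ (convex hull of finitely many points of $\mathbb{Q}^n$) of dimension $d$, Ehrhart's theorem states that $L_{\mathcal{P}}(k):=\#(k\mathcal{P}\cap\mathbb{Z}^n)$, $k\in\mathbb{Z}_{>0}$, agrees with a (unique) quasi-polynomial of degree $d$, called the Ehrhart quasi-polynomial of $\mathcal{P}$ and again denoted $L_{\mathcal{P}}$; it is evaluated at $k=0$ as a quasi-polynomial. The convolution of quasi-polynomials $A$ and $B$ of degrees $d$ and $e$ is $C(k)=\sum_{m=0}^k A(k-m)B(m)$ for $k\ge 0$; it agrees for $k\ge0$ with a unique quasi-polynomial, of the form $\sum_{j=0}^{d+e+1}c_j(k)k^j$, and its coefficient functions $c_j$ are those of this quasi-polynomial. In the final formula, a list $\hat\alpha_{j+1},\dots,\hat\alpha_d$ (resp. $\hat\beta_{j+1},\dots,\hat\beta_e$)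 is empty when $j+1>d$ (resp. $j+1>e$). -}

module Defs where

open import Data.Fin.Base using (Fin; toℕ)
open import Data.Fin.Properties using () renaming (_≟_ to _≟ᶠ_)
open import Data.Integer.Base as ℤ using (ℤ; +_)
open import Data.List.Base using (List; length; map; filter; foldr; allFin; cartesianProduct)
open import Data.List.Membership.Propositional using (_∈_)
open import Data.List.Relation.Unary.Unique.Propositional using (Unique)
open import Data.Nat.Base as ℕ using (ℕ; zero; suc; NonZero)
open import Data.Nat.Divisibility using (_∣_)
open import Data.Nat.GCD using (gcd)
open import Data.Nat.LCM using (lcm)
open import Data.Nat.Properties using () renaming (_≟_ to _≟ⁿ_; _≤?_ to _≤ⁿ?_)
open import Data.Product.Base using (∃-syntax; _×_; _,_)
open import Data.Rational.Base using (ℚ; 0ℚ; 1ℚ; _/_; _*_; _≤_)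
open import Data.Rational.Properties using (+-0-commutativeMonoid)
open import Data.Vec.Base using (Vec; lookup)
open import Data.Vec.Functional using (Vector)
open import Function.Bundles using (_⇔_)
open import Function.Definitions using (Injective)
open import Level using (0ℓ)
open import Relation.Binary.PropositionalEquality using (_≡_; _≢_)
open import Relation.Nullary.Decidable using (does)
open import Relation.Unary using (Pred)
open import Data.Bool.Base using (if_then_else_)

open import Algebra.Properties.CommutativeMonoid.Sum +-0-commutativeMonoid public
  using (sum; sum-syntax; sum⁺-syntax)

fromℤ : ℤ → ℚ
fromℤ k = k / 1

fromℕ : ℕ → ℚ
fromℕ n = fromℤ (+ n)

IsPeriod : (ℤ → ℚ) → ℕ → Set
IsPeriod c p = ∀ k → c (k ℤ.+ + p) ≡ c k

Periodic : (ℤ → ℚ) → Set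
Periodic c = ∃[ p ] NonZero p × IsPeriod c p

record IsMinPeriod (c : ℤ → ℚ) (p : ℕ) : Set where
  field
    positive : NonZero p
    isPeriod : IsPeriod c p
    minimal  : ∀ q → NonZero q → IsPeriod c q → p ℕ.≤ q

-- The leading coefficient function is not required to be nonzero: d only
-- bounds the degree.
record QuasiPolynomial (d : ℕ) : Set where
  field
    coeff    : Fin (suc d) → ℤ → ℚ
    periodic : ∀ j → Periodic (coeff j)

open QuasiPolynomial public

eval : ∀ {d} → QuasiPolynomial d → ℤ → ℚ
eval {d} q k = ∑[ j ≤ d ] (coeff q j k * fromℤ (k ℤ.^ toℕ j))

convolution : (ℤ → ℚ) → (ℤ → ℚ) → ℕ → ℚ
convolution A B k = ∑[ m ≤ k ] (A (+ k ℤ.- + toℕ m) * B (+ toℕ m))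

IsConvolution : ∀ {d e f} → QuasiPolynomial d → QuasiPolynomial e →
                QuasiPolynomial f → Set
IsConvolution a b c = ∀ k → eval c (+ k) ≡ convolution (eval a) (eval b) k

-- Only the rational points of the ambient real space are represented.  A
-- rational point lies in the real convex hull of finitely many rational
-- points iff it is a convex combination of them with rational weights, so
-- the integer points of every dilate are unaffected.
Point : ℕ → Set
Point n = Vector ℚ n

record ConvexHull {m n} (v : Fin m → Point n) (x : Point n) : Set where
  field
    weight      : Fin m → ℚ
    nonNegative : ∀ i → 0ℚ ≤ weight i
    sumsToOne   : sum weight ≡ 1ℚ
    combination : ∀ l → x l ≡ ∑[ i < m ] (weight i * v i l)

dilate : ∀ {n} → ℕ → Pred (Point n) 0ℓ → Pred (Point n) 0ℓ
dilate k P x = ∃[ p ] P p × (∀ l → x l ≡ fromℕ k * p l)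

LatticePoint : ∀ {n} → Pred (Point n) 0ℓ → Pred (Vec ℤ n) 0ℓ
LatticePoint P z = P (λ l → fromℤ (lookup z l))

HasCardinality : ∀ {A : Set} → Pred A 0ℓ → ℕ → Set
HasCardinality {A} P N =
  ∃[ xs ] Unique xs × (∀ (x : A) → x ∈ xs ⇔ P x) × length xs ≡ N

IsEhrhart : ∀ {n d} → Pred (Point n) 0ℓ → QuasiPolynomial d → Set
IsEhrhart P q = ∀ k → NonZero k →
  ∃[ N ] HasCardinality (LatticePoint (dilate k P)) N × eval q (+ k) ≡ fromℕ N

axisPoint : ∀ {n} (α : Fin n → ℕ) → (∀ i → NonZero (α i)) → Fin n → Point n
axisPoint α α≢0 i l = if does (i ≟ᶠ l) then (+ 1 / α i) {{α≢0 i}} else 0ℚ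

Simplex : ∀ {n} (α : Fin n → ℕ) → (∀ i → NonZero (α i)) → Pred (Point n) 0ℓ
Simplex α α≢0 = ConvexHull (axisPoint α α≢0)

-- α_d ∣ ⋯ ∣ α_e ∣ β_e ∣ α_{e-1} ∣ β_{e-1} ∣ ⋯ ∣ α_0 ∣ β_0
record DivisibilityChain {d e} (α : Fin (suc d) → ℕ) (β : Fin (suc e) → ℕ) : Set where
  field
    α∣α : ∀ i i′ → e ℕ.≤ toℕ i → toℕ i′ ≡ suc (toℕ i) → α i′ ∣ α i
    α∣β : ∀ i l → toℕ i ≡ toℕ l → α i ∣ β l
    β∣α : ∀ i l → toℕ l ≡ suc (toℕ i) → β l ∣ α i

record Distinct {d e} (α : Fin (suc d) → ℕ) (β : Fin (suc e) → ℕ) : Set where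
  field
    α-injective : Injective _≡_ _≡_ α
    β-injective : Injective _≡_ _≡_ β
    α≢β         : ∀ i l → α i ≢ β l

lcmList : List ℕ → ℕ
lcmList = foldr lcm 1

-- [ f_J , … , f_d ], empty when J > d
from : ∀ {d} → ℕ → (Fin (suc d) → ℕ) → List ℕ
from {d} J f = map f (filter (λ i → J ≤ⁿ? toℕ i) (allFin (suc d)))

-- The index is shifted by one so as to start at 0: gShifted α̂ β̂ (j + 1) is
-- g_j for -1 ≤ j, with i + l ≡ j standing for l = j - i.
gShifted : ∀ {d e} → (Fin (suc d) → ℕ) → (Fin (suc e) → ℕ) → ℕ → ℕ
gShifted         α̂ β̂ zero    = 1
gShifted {d} {e} α̂ β̂ (suc j) =
  lcmList (map (λ (i , l) → gcd (α̂ i) (β̂ l))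
    (filter (λ (i , l) → toℕ i ℕ.+ toℕ l ≟ⁿ j)
      (cartesianProduct (allFin (suc d)) (allFin (suc e)))))

{-# OPTIONS --safe #-}
-- Ehrhart counting turns L_Δ₁, L_Δ₂ and C into the coefficient sequences of
-- 1 / ∏ (1 - z ^ s), with s over the α's, the β's and all of them, and in each
-- case these s form a strictly decreasing divisibility chain s 0, s 1, ….  For
-- such a chain the j-th coefficient function has minimum period s j: multiply
-- by the factors 1 - z ^ s one at a time, the smallest first.  On
-- quasi-polynomials this is a backward difference, and the periods are read
-- off from the fact that a periodic function has no nonzero constant drift.
-- That s j is minimal comes down to the indicator function of s j ∣ k not being
-- the sum of a p-periodic and an m-periodic function with 0 < p, m < s j.  The
-- merged chain is β₀, α₀, β₁, α₁, …, β_e, α_e, α_{e+1}, …, α_d, and the lcm in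
-- the theorem picks out its J-th term.
module Submission where

open import Defs
open import Algebra.Bundles using (CommutativeRing)
import Algebra.Properties.CommutativeSemigroup as CommutativeSemigroupProperties
import Algebra.Properties.Semiring.Sum as SemiringSum
open import Data.Empty using (⊥)
open import Data.Fin.Base using (Fin; toℕ; fromℕ<; zero; suc)
import Data.Fin.Properties as Finₚ
open import Data.Integer.Base as ℤ using (ℤ; +_; -[1+_])
import Data.Integer.Properties as ℤₚ
open import Data.List.Base
  using (List; _++_; _∷_; []; map; tabulate; applyUpTo; applyDownFrom; filter; allFin; cartesianProduct)
import Data.List.Properties as Listₚ
open import Data.List.Membership.Propositional using (_∈_)
open import Data.List.Membership.Propositional.Properties
  using (∈-map⁺; ∈-map⁻; ∈-++⁺ˡ; ∈-++⁺ʳ; ∈-++⁻; ∈-filter⁺; ∈-filter⁻; ∈-allFin; ∈-cartesianProduct⁺)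
open import Data.List.Membership.Propositional.Properties.WithK using (unique∧set⇒bag)
open import Data.List.Relation.Binary.BagAndSetEquality using (∼bag⇒↭)
open import Data.List.Relation.Binary.Permutation.Propositional as Perm using (_↭_)
open import Data.List.Relation.Binary.Permutation.Propositional.Properties using (↭-length; shift; ↭-reverse)
open import Data.List.Relation.Unary.All using (All; []; _∷_)
import Data.List.Relation.Unary.All.Properties as Allₚ
open import Data.List.Relation.Unary.Any using (here; there)
open import Data.List.Relation.Unary.Unique.Propositional using ([]; _∷_)
import Data.List.Relation.Unary.Unique.Propositional.Properties as Uniqueₚ
open import Data.Nat.Base as ℕ using (ℕ; zero; suc; NonZero; _≤_; _<_; z≤n; s≤s)
import Data.Nat.Properties as ℕₚ
open import Data.Nat.DivMod using (_%_; _/_; m≡m%n+[m/n]*n; m%n<n)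
open import Data.Nat.Divisibility
  using (_∣_; _∣?_; divides; ∣-refl; ∣-trans; ∣-antisym; ∣⇒≤; >⇒∤; 1∣_; m∣m*n; n∣m*n; ∣m+n∣m⇒∣n; m%n≡0⇒n∣m)
open import Data.Nat.GCD using (gcd; gcd[m,n]∣m; gcd[m,n]∣n; gcd-greatest)
open import Data.Nat.Induction using (<-rec)
open import Data.Nat.LCM using (m∣lcm[m,n]; n∣lcm[m,n]; lcm-least)
open import Data.Product.Base using (_×_; _,_; proj₁; proj₂; ∃-syntax)
open import Data.Rational.Base as ℚ using (ℚ; 0ℚ; 1ℚ; _+_; _*_; _-_; -_; toℚᵘ)
import Data.Rational.Properties as ℚₚ
open import Data.Rational.Solver using (module +-*-Solver)
import Data.Rational.Unnormalised.Base as ℚᵘ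
import Data.Rational.Unnormalised.Properties as ℚᵘₚ
open import Data.Sum.Base as Sum using (_⊎_; inj₁; inj₂)
open import Data.Vec.Base as Vec using (Vec; []; _∷_; lookup)
import Data.Vec.Properties as Vecₚ
open import Function.Base using (_∘_)
open import Function.Bundles using (_⇔_; mk⇔; Equivalence)
open import Function.Properties.Equivalence using () renaming (sym to ⇔-sym; trans to ⇔-trans)
open import Level using (0ℓ)
open import Relation.Binary.PropositionalEquality
open import Relation.Nullary using (¬_; contradiction; yes; no)
open import Relation.Nullary.Decidable using (dec-true; dec-false)
open import Relation.Unary using (Pred; _∪_; _∩_; Empty)

open +-*-Solver using (solve; _:+_; _:*_; _:-_; _:=_; con)
open CommutativeSemigroupProperties ℤₚ.+-commutativeSemigroup using (xy∙z≈xz∙y)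
open SemiringSum (CommutativeRing.semiring ℚₚ.+-*-commutativeRing)
  using (sum-cong-≗; *-distribˡ-sum; *-distribʳ-sum)

-- No formula for the coefficient functions is written down. What links them to their differences is
-- a carry: the j-th coefficient of q k - q (k - s) is the backward difference of the j-th
-- coefficient of q, minus a combination of shifted higher coefficients. Arguments therefore run
-- from the top coefficient down. Taking the smallest s first makes the step divide every period in
-- play, which is what lets a period of a difference pass back to the function. For minimality the
-- carry is the obstacle: it perturbs the j-th coefficient by functions whose periods divide s (j +
-- 1), so the failure of a period p alone would not survive the induction. Hence the claim about
-- sums, whose second summand has a period divisible by s (j + 1) and absorbs the carry. Only the
-- top coefficient is new at each stage, and it is a nonzero multiple of an indicator. A second
-- obstacle is the argument 0: an Ehrhart quasi-polynomial is prescribed on positive integers only,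
-- but the convolution uses its value at 0, which has to be recovered from the generating function.

-- Integers inside the rationals.

toℚᵘ-fromℤ : ∀ k → toℚᵘ (fromℤ k) ℚᵘ.≃ ℚᵘ.mkℚᵘ k 0
toℚᵘ-fromℤ k = ℚₚ.toℚᵘ-fromℚᵘ (ℚᵘ.mkℚᵘ k 0)

fromℤ-injective : ∀ {j k} → fromℤ j ≡ fromℤ k → j ≡ k
fromℤ-injective {j} {k} eq = ℤₚ.*-cancelʳ-≡ j k (+ 1) (ℚᵘₚ.drop-*≡*
  (ℚᵘₚ.≃-trans (ℚᵘₚ.≃-sym (toℚᵘ-fromℤ j)) (ℚᵘₚ.≃-trans (ℚₚ.toℚᵘ-cong eq) (toℚᵘ-fromℤ k))))

fromℤ-+ : ∀ j k → fromℤ (j ℤ.+ k) ≡ fromℤ j + fromℤ k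
fromℤ-+ j k = ℚₚ.toℚᵘ-injective (begin-equality
  toℚᵘ (fromℤ (j ℤ.+ k))              ≃⟨ toℚᵘ-fromℤ (j ℤ.+ k) ⟩
  ℚᵘ.mkℚᵘ (j ℤ.+ k) 0                 ≃⟨ ℚᵘ.*≡* (cong (ℤ._* + 1)
    (cong₂ ℤ._+_ (sym (ℤₚ.*-identityʳ j)) (sym (ℤₚ.*-identityʳ k)))) ⟩
  ℚᵘ.mkℚᵘ j 0 ℚᵘ.+ ℚᵘ.mkℚᵘ k 0        ≃⟨ ℚᵘₚ.+-cong (toℚᵘ-fromℤ j) (toℚᵘ-fromℤ k) ⟨
  toℚᵘ (fromℤ j) ℚᵘ.+ toℚᵘ (fromℤ k)  ≃⟨ ℚₚ.toℚᵘ-homo-+ (fromℤ j) (fromℤ k) ⟨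
  toℚᵘ (fromℤ j + fromℤ k)            ∎)
  where open ℚᵘₚ.≤-Reasoning

fromℤ-* : ∀ j k → fromℤ (j ℤ.* k) ≡ fromℤ j * fromℤ k
fromℤ-* j k = ℚₚ.toℚᵘ-injective (begin-equality
  toℚᵘ (fromℤ (j ℤ.* k))              ≃⟨ toℚᵘ-fromℤ (j ℤ.* k) ⟩
  ℚᵘ.mkℚᵘ j 0 ℚᵘ.* ℚᵘ.mkℚᵘ k 0        ≃⟨ ℚᵘₚ.*-cong (toℚᵘ-fromℤ j) (toℚᵘ-fromℤ k) ⟨
  toℚᵘ (fromℤ j) ℚᵘ.* toℚᵘ (fromℤ k)  ≃⟨ ℚₚ.toℚᵘ-homo-* (fromℤ j) (fromℤ k) ⟨
  toℚᵘ (fromℤ j * fromℤ k)            ∎)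
  where open ℚᵘₚ.≤-Reasoning

fromℕ-+ : ∀ m n → fromℕ (m ℕ.+ n) ≡ fromℕ m + fromℕ n
fromℕ-+ m n = fromℤ-+ (+ m) (+ n)

fromℕ-* : ∀ m n → fromℕ (m ℕ.* n) ≡ fromℕ m * fromℕ n
fromℕ-* m n = trans (cong fromℤ (ℤₚ.pos-* m n)) (fromℤ-* (+ m) (+ n))

fromℕ-suc : ∀ n → fromℕ (suc n) ≡ 1ℚ + fromℕ n
fromℕ-suc = fromℕ-+ 1

x*y≡0⇒y≡0 : ∀ {x y} → x ≢ 0ℚ → x * y ≡ 0ℚ → y ≡ 0ℚ
x*y≡0⇒y≡0 {x} {y} x≢0 xy≡0 = begin
  y                ≡⟨ ℚₚ.*-identityˡ y ⟨
  1ℚ * y           ≡⟨ cong (_* y) (ℚₚ.*-inverseˡ x) ⟨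
  ℚ.1/ x * x * y   ≡⟨ ℚₚ.*-assoc (ℚ.1/ x) x y ⟩
  ℚ.1/ x * (x * y) ≡⟨ cong (ℚ.1/ x *_) xy≡0 ⟩
  ℚ.1/ x * 0ℚ      ≡⟨ ℚₚ.*-zeroʳ (ℚ.1/ x) ⟩
  0ℚ               ∎
  where
  open ≡-Reasoning
  instance _ = ℚ.≢-nonZero x≢0

fromℤ≢0 : ∀ {k} → k ≢ + 0 → fromℤ k ≢ 0ℚ
fromℤ≢0 k≢0 eq = k≢0 (fromℤ-injective eq)

fromℕ≢0 : ∀ {n} → 0 < n → fromℕ n ≢ 0ℚ
fromℕ≢0 0<n = fromℤ≢0 λ eq → ℕₚ.<⇒≢ 0<n (sym (ℤₚ.+-injective eq))

x-y≡0⇒x≡y : ∀ {x y} → x - y ≡ 0ℚ → x ≡ y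
x-y≡0⇒x≡y {x} {y} eq = begin
  x         ≡⟨ solve 2 (λ x y → x := (x :- y) :+ y) refl x y ⟩
  x - y + y ≡⟨ cong (_+ y) eq ⟩
  0ℚ + y    ≡⟨ ℚₚ.+-identityˡ y ⟩
  y         ∎
  where open ≡-Reasoning

-- The increment is assumed constant only below `n`, because `Telescope` controls it over a bounded
-- range only.
linear-drift : ∀ (h : ℕ → ℚ) x n → (∀ t → t < n → h (suc t) ≡ h t + x) →
               h n ≡ h 0 + fromℕ n * x
linear-drift h x zero    step = solve 2 (λ a x → a := a :+ con 0ℚ :* x) refl (h 0) x
linear-drift h x (suc n) step = begin
  h (suc n)                ≡⟨ step n ℕₚ.≤-refl ⟩
  h n + x                  ≡⟨ cong (_+ x) (linear-drift h x n λ t t<n → step t (ℕₚ.m<n⇒m<1+n t<n)) ⟩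
  h 0 + fromℕ n * x + x    ≡⟨ solve 3 (λ a n x → a :+ n :* x :+ x := a :+ (con 1ℚ :+ n) :* x) refl (h 0) (fromℕ n) x ⟩
  h 0 + (1ℚ + fromℕ n) * x ≡⟨ cong (λ y → h 0 + y * x) (fromℕ-suc n) ⟨
  h 0 + fromℕ (suc n) * x  ∎
  where open ≡-Reasoning

-- Periodic functions on the integers.

i+j-j≡i : ∀ i j → i ℤ.+ j ℤ.+ ℤ.- j ≡ i
i+j-j≡i i j = trans (ℤₚ.+-assoc i j (ℤ.- j)) (trans (cong (λ x → i ℤ.+ x) (ℤₚ.+-inverseʳ j)) (ℤₚ.+-identityʳ i))

IsPeriod-multiple : ∀ {c p} n → IsPeriod c p → IsPeriod c (n ℕ.* p)
IsPeriod-multiple {c} {p} zero    per k = cong c (ℤₚ.+-identityʳ k)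
IsPeriod-multiple {c} {p} (suc n) per k = begin
  c (k ℤ.+ + (p ℕ.+ n ℕ.* p))     ≡⟨ cong (λ i → c (k ℤ.+ + i)) (ℕₚ.+-comm p (n ℕ.* p)) ⟩
  c (k ℤ.+ + (n ℕ.* p ℕ.+ p))     ≡⟨ cong c (ℤₚ.+-assoc k (+ (n ℕ.* p)) (+ p)) ⟨
  c (k ℤ.+ + (n ℕ.* p) ℤ.+ + p)   ≡⟨ per (k ℤ.+ + (n ℕ.* p)) ⟩
  c (k ℤ.+ + (n ℕ.* p))           ≡⟨ IsPeriod-multiple n per k ⟩
  c k                             ∎
  where open ≡-Reasoning

IsPeriod-∣ : ∀ {c p q} → p ∣ q → IsPeriod c p → IsPeriod c q
IsPeriod-∣ {c} (divides n refl) per = IsPeriod-multiple {c} n per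

IsPeriod-back : ∀ {c p} → IsPeriod c p → ∀ k → c (k ℤ.+ ℤ.- + p) ≡ c k
IsPeriod-back {c} {p} per k = begin
  c (k ℤ.+ ℤ.- + p)             ≡⟨ per _ ⟨
  c (k ℤ.+ ℤ.- + p ℤ.+ + p)     ≡⟨ cong c (trans (ℤₚ.+-assoc k (ℤ.- + p) (+ p))
                                     (trans (cong (λ i → k ℤ.+ i) (ℤₚ.+-inverseˡ (+ p))) (ℤₚ.+-identityʳ k))) ⟩
  c k                           ∎
  where open ≡-Reasoning

-- A carry is built from higher coefficients by exactly these operations. Having a given period and
-- vanishing are both closed under them, so a single induction on carries serves both.
record Subspace (Q : (ℤ → ℚ) → Set) : Set where
  field
    0∈     : Q (λ _ → 0ℚ)
    shift∈ : ∀ {f} m → Q f → Q (λ k → f (k ℤ.+ m))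
    +∈     : ∀ {f g} → Q f → Q g → Q (λ k → f k + g k)
    *∈     : ∀ {f} x → Q f → Q (λ k → x * f k)

IsPeriod-subspace : ∀ p → Subspace (λ c → IsPeriod c p)
IsPeriod-subspace p = record
  { 0∈     = λ _ → refl
  ; shift∈ = λ {f} m per k → trans (cong f (xy∙z≈xz∙y k (+ p) m)) (per (k ℤ.+ m))
  ; +∈     = λ per₁ per₂ k → cong₂ _+_ (per₁ k) (per₂ k)
  ; *∈     = λ x per k → cong (x *_) (per k)
  }

vanishing-subspace : Subspace (λ c → ∀ k → c k ≡ 0ℚ)
vanishing-subspace = record
  { 0∈     = λ _ → refl
  ; shift∈ = λ m f≡0 k → f≡0 (k ℤ.+ m)
  ; +∈     = λ f≡0 g≡0 k → cong₂ _+_ (f≡0 k) (g≡0 k)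
  ; *∈     = λ x f≡0 k → trans (cong (x *_) (f≡0 k)) (ℚₚ.*-zeroʳ x)
  }

-- Coefficient sequences and translation of the argument.

Coeffs : Set
Coeffs = ℕ → ℤ → ℚ

VanishesFrom : ℕ → Coeffs → Set
VanishesFrom N C = ∀ j → N ≤ j → ∀ k → C j k ≡ 0ℚ

ev : ℕ → Coeffs → ℤ → ℚ
ev zero    C k = 0ℚ
ev (suc N) C k = C 0 k + fromℤ k * ev N (C ∘ suc) k

ev-cong : ∀ N {C D : Coeffs} k → (∀ j → C j k ≡ D j k) → ev N C k ≡ ev N D k
ev-cong zero    k eq = refl
ev-cong (suc N) k eq = cong₂ _+_ (eq 0) (cong (fromℤ k *_) (ev-cong N k (eq ∘ suc)))

ev-+* : ∀ N (C D : Coeffs) x k → ev N (λ j k → C j k + x * D j k) k ≡ ev N C k + x * ev N D k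
ev-+* zero    C D x k = solve 1 (λ x → con 0ℚ := con 0ℚ :+ x :* con 0ℚ) refl x
ev-+* (suc N) C D x k = begin
  C 0 k + x * D 0 k + fromℤ k * ev N (λ j k → C (suc j) k + x * D (suc j) k) k
    ≡⟨ cong (λ y → C 0 k + x * D 0 k + fromℤ k * y) (ev-+* N (C ∘ suc) (D ∘ suc) x k) ⟩
  C 0 k + x * D 0 k + fromℤ k * (ev N (C ∘ suc) k + x * ev N (D ∘ suc) k)
    ≡⟨ solve 6 (λ c d x k C D → c :+ x :* d :+ k :* (C :+ x :* D) := c :+ k :* C :+ x :* (d :+ k :* D)) refl
         (C 0 k) (D 0 k) x (fromℤ k) (ev N (C ∘ suc) k) (ev N (D ∘ suc) k) ⟩
  C 0 k + fromℤ k * ev N (C ∘ suc) k + x * (D 0 k + fromℤ k * ev N (D ∘ suc) k) ∎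
  where open ≡-Reasoning

ev-vanishing : ∀ N (C : Coeffs) k → (∀ j → j < N → C j k ≡ 0ℚ) → ev N C k ≡ 0ℚ
ev-vanishing zero    C k C≡0 = refl
ev-vanishing (suc N) C k C≡0 = begin
  C 0 k + fromℤ k * ev N (C ∘ suc) k
    ≡⟨ cong₂ (λ x y → x + fromℤ k * y) (C≡0 0 (s≤s z≤n)) (ev-vanishing N (C ∘ suc) k (λ j j<N → C≡0 (suc j) (s≤s j<N))) ⟩
  0ℚ + fromℤ k * 0ℚ
    ≡⟨ solve 1 (λ k → con 0ℚ :+ k :* con 0ℚ := con 0ℚ) refl (fromℤ k) ⟩
  0ℚ ∎
  where open ≡-Reasoning

ev-extend : ∀ N {C} → VanishesFrom N C → ∀ k → ev (suc N) C k ≡ ev N C k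
ev-extend zero    {C} C≡0 k = ev-vanishing 1 C k (λ j _ → C≡0 j z≤n k)
ev-extend (suc N) {C} C≡0 k = cong (λ y → C 0 k + fromℤ k * y)
  (ev-extend N (λ j N≤j → C≡0 (suc j) (s≤s N≤j)) k)

-- The coefficient of k ^ j in q (k + m) is C j (k + m) + carry m N C j k.
carry : ℤ → ℕ → Coeffs → Coeffs
carry m zero    C j       k = 0ℚ
carry m (suc N) C zero    k = fromℤ m * (C 1 (k ℤ.+ m) + carry m N (C ∘ suc) 0 k)
carry m (suc N) C (suc j) k =
  carry m N (C ∘ suc) j k + fromℤ m * (C (suc (suc j)) (k ℤ.+ m) + carry m N (C ∘ suc) (suc j) k)

translate : ℤ → ℕ → Coeffs → Coeffs
translate m N C j k = C j (k ℤ.+ m) + carry m N C j k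

carry∈ : ∀ {Q} → Subspace Q → ∀ m N C j → (∀ i → j < i → Q (C i)) → Q (carry m N C j)
carry∈ S m zero    C j       C∈ = Subspace.0∈ S
carry∈ S m (suc N) C zero    C∈ =
  *∈ (fromℤ m) (+∈ (shift∈ m (C∈ 1 (s≤s z≤n))) (carry∈ S m N (C ∘ suc) 0 (λ i 0<i → C∈ (suc i) (s≤s z≤n))))
  where open Subspace S
carry∈ S m (suc N) C (suc j) C∈ =
  +∈ (carry∈ S m N (C ∘ suc) j (λ i j<i → C∈ (suc i) (s≤s j<i)))
     (*∈ (fromℤ m) (+∈ (shift∈ m (C∈ (suc (suc j)) ℕₚ.≤-refl))
       (carry∈ S m N (C ∘ suc) (suc j) (λ i j<i → C∈ (suc i) (s≤s (ℕₚ.<⇒≤ j<i))))))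
  where open Subspace S

carry-vanishes : ∀ m N {C} → VanishesFrom N C → ∀ j → N ≤ suc j → ∀ k → carry m N C j k ≡ 0ℚ
carry-vanishes m N {C} C≡0 j N≤1+j =
  carry∈ vanishing-subspace m N C j (λ i j<i → C≡0 i (ℕₚ.≤-trans N≤1+j j<i))

translate-vanishes : ∀ m N {C} → VanishesFrom N C → VanishesFrom N (translate m N C)
translate-vanishes m N C≡0 j N≤j k =
  cong₂ _+_ (C≡0 j N≤j (k ℤ.+ m)) (carry-vanishes m N C≡0 j (ℕₚ.m≤n⇒m≤1+n N≤j) k)

-- With the higher coefficients gone, only the linear term in m of (k + m) ^ (j + 1) contributes,
-- which puts (j + 1) m in front of k ^ j. Through this a coefficient is recovered from the carry
-- that it leaves one degree lower.
carry-leading : ∀ m N {C} → VanishesFrom N C → ∀ j → VanishesFrom (suc (suc j)) C →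
                ∀ k → carry m N C j k ≡ fromℕ (suc j) * (fromℤ m * C (suc j) (k ℤ.+ m))
carry-leading m zero {C} C≡0 j _ k = begin
  0ℚ
    ≡⟨ solve 2 (λ a b → con 0ℚ := a :* (b :* con 0ℚ)) refl (fromℕ (suc j)) (fromℤ m) ⟩
  fromℕ (suc j) * (fromℤ m * 0ℚ)
    ≡⟨ cong (λ y → fromℕ (suc j) * (fromℤ m * y)) (C≡0 (suc j) z≤n (k ℤ.+ m)) ⟨
  fromℕ (suc j) * (fromℤ m * C (suc j) (k ℤ.+ m)) ∎
  where open ≡-Reasoning
carry-leading m (suc N) {C} C≡0 zero D≡0 k = begin
  fromℤ m * (C 1 (k ℤ.+ m) + carry m N (C ∘ suc) 0 k)
    ≡⟨ cong (λ y → fromℤ m * (C 1 (k ℤ.+ m) + y))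
         (carry∈ vanishing-subspace m N (C ∘ suc) 0 (λ i 0<i → D≡0 (suc i) (s≤s 0<i)) k) ⟩
  fromℤ m * (C 1 (k ℤ.+ m) + 0ℚ)
    ≡⟨ solve 2 (λ a b → a :* (b :+ con 0ℚ) := con 1ℚ :* (a :* b)) refl (fromℤ m) (C 1 (k ℤ.+ m)) ⟩
  1ℚ * (fromℤ m * C 1 (k ℤ.+ m)) ∎
  where open ≡-Reasoning
carry-leading m (suc N) {C} C≡0 (suc j) D≡0 k = begin
  carry m N (C ∘ suc) j k + fromℤ m * (c + carry m N (C ∘ suc) (suc j) k)
    ≡⟨ cong₂ (λ x y → x + fromℤ m * (c + y))
         (carry-leading m N (λ i N≤i → C≡0 (suc i) (s≤s N≤i)) j (λ i j<i → D≡0 (suc i) (s≤s j<i)) k)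
         (carry∈ vanishing-subspace m N (C ∘ suc) (suc j) (λ i j<i → D≡0 (suc i) (s≤s j<i)) k) ⟩
  fromℕ (suc j) * (fromℤ m * c) + fromℤ m * (c + 0ℚ)
    ≡⟨ solve 3 (λ n m c → n :* (m :* c) :+ m :* (c :+ con 0ℚ) := (con 1ℚ :+ n) :* (m :* c)) refl
         (fromℕ (suc j)) (fromℤ m) c ⟩
  (1ℚ + fromℕ (suc j)) * (fromℤ m * c)
    ≡⟨ cong (_* (fromℤ m * c)) (fromℕ-suc (suc j)) ⟨
  fromℕ (suc (suc j)) * (fromℤ m * c) ∎
  where
  open ≡-Reasoning
  c = C (suc (suc j)) (k ℤ.+ m)

ev-translate : ∀ m N {C} → VanishesFrom N C → ∀ k → ev N (translate m N C) k ≡ ev N C (k ℤ.+ m)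
ev-translate m zero    {C} C≡0 k = refl
ev-translate m (suc N) {C} C≡0 k = begin
  c + fromℤ m * T 0 k + fromℤ k * ev N (λ j k → C (suc j) (k ℤ.+ m) + (carry m N C⁺ j k + fromℤ m * T (suc j) k)) k
    ≡⟨ cong (λ y → c + fromℤ m * T 0 k + fromℤ k * y) (trans
         (ev-cong N k (λ j → sym (ℚₚ.+-assoc (C (suc j) (k ℤ.+ m)) (carry m N C⁺ j k) (fromℤ m * T (suc j) k))))
         (ev-+* N T (T ∘ suc) (fromℤ m) k)) ⟩
  c + fromℤ m * T 0 k + fromℤ k * (ev N T k + fromℤ m * ev N (T ∘ suc) k)
    ≡⟨ solve 6 (λ c m t k x y → c :+ m :* t :+ k :* (x :+ m :* y) := c :+ k :* x :+ m :* (t :+ k :* y)) refl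
         c (fromℤ m) (T 0 k) (fromℤ k) (ev N T k) (ev N (T ∘ suc) k) ⟩
  c + fromℤ k * ev N T k + fromℤ m * ev (suc N) T k
    -- Translation keeps the degree bound, so the extra top term of `T` is zero.
    ≡⟨ cong (λ y → c + fromℤ k * ev N T k + fromℤ m * y) (ev-extend N (translate-vanishes m N C⁺≡0) k) ⟩
  c + fromℤ k * ev N T k + fromℤ m * ev N T k
    ≡⟨ solve 4 (λ c k m x → c :+ k :* x :+ m :* x := c :+ (k :+ m) :* x) refl c (fromℤ k) (fromℤ m) (ev N T k) ⟩
  c + (fromℤ k + fromℤ m) * ev N T k
    ≡⟨ cong₂ (λ x y → c + x * y) (sym (fromℤ-+ k m)) (ev-translate m N C⁺≡0 k) ⟩
  c + fromℤ (k ℤ.+ m) * ev N C⁺ (k ℤ.+ m) ∎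
  where
  open ≡-Reasoning
  C⁺ = C ∘ suc
  T = translate m N C⁺
  c = C 0 (k ℤ.+ m)
  C⁺≡0 : VanishesFrom N C⁺
  C⁺≡0 j N≤j = C≡0 (suc j) (s≤s N≤j)

-- A quasi-polynomial is determined by its values at large arguments.

reach : ∀ P → 0 < P → ∀ K k → ∃[ n ] ∃[ t ] k ℤ.+ + (n ℕ.* P) ≡ + t × K ≤ t
reach P 0<P K (+ a) = K , a ℕ.+ K ℕ.* P , refl , (begin
  K               ≤⟨ ℕₚ.m≤m*n K P {{ℕ.>-nonZero 0<P}} ⟩
  K ℕ.* P         ≤⟨ ℕₚ.m≤n+m _ a ⟩
  a ℕ.+ K ℕ.* P   ∎)
  where open ℕₚ.≤-Reasoning
reach (suc p) 0<P K -[1+ a ] = suc a ℕ.+ K , K ℕ.+ (suc a ℕ.+ K) ℕ.* p , (begin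
  -[1+ a ] ℤ.+ + ((suc a ℕ.+ K) ℕ.* suc p)
    ≡⟨ cong (λ i → -[1+ a ] ℤ.+ + i) (trans (ℕₚ.*-suc (suc a ℕ.+ K) p) (ℕₚ.+-assoc (suc a) K _)) ⟩
  -[1+ a ] ℤ.+ (+ suc a ℤ.+ + (K ℕ.+ (suc a ℕ.+ K) ℕ.* p))
    ≡⟨ ℤₚ.+-assoc -[1+ a ] (+ suc a) _ ⟨
  -[1+ a ] ℤ.+ + suc a ℤ.+ + (K ℕ.+ (suc a ℕ.+ K) ℕ.* p)
    ≡⟨ cong (λ i → i ℤ.+ + (K ℕ.+ (suc a ℕ.+ K) ℕ.* p)) (ℤₚ.+-inverseˡ (+ suc a)) ⟩
  + 0 ℤ.+ + (K ℕ.+ (suc a ℕ.+ K) ℕ.* p)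
    ≡⟨ ℤₚ.+-identityˡ _ ⟩
  + (K ℕ.+ (suc a ℕ.+ K) ℕ.* p) ∎) , ℕₚ.m≤m+n K _
  where open ≡-Reasoning

IsPeriod-eventually : ∀ {c P K x} → 0 < P → IsPeriod c P → (∀ k → K ≤ k → c (+ k) ≡ x) → ∀ k → c k ≡ x
IsPeriod-eventually {c} {P} {K} 0<P per eq k with n , t , k+nP≡t , K≤t ← reach P 0<P K k =
  trans (sym (IsPeriod-multiple {c} n per k)) (trans (cong c k+nP≡t) (eq t K≤t))

-- Since (1 + P) k and k agree modulo P, only the powers of the argument notice the factor 1 + P.
-- The additional exponent `i` is what the Horner recursion accumulates.
ev-dilate : ∀ N P D → (∀ j → IsPeriod (D j) P) → ∀ i k →
            fromℕ (suc P ℕ.^ i) * ev N D (+ (suc P ℕ.* k)) ≡ ev N (λ j k → fromℕ (suc P ℕ.^ (i ℕ.+ j)) * D j k) (+ k)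
ev-dilate zero    P D per i k = ℚₚ.*-zeroʳ (fromℕ (suc P ℕ.^ i))
ev-dilate (suc N) P D per i k = begin
  v * (D 0 (+ (suc P ℕ.* k)) + fromℕ (suc P ℕ.* k) * E)
    ≡⟨ cong₂ (λ x y → v * (x + y * E)) D₀ (fromℕ-* (suc P) k) ⟩
  v * (D 0 (+ k) + u * fromℕ k * E)
    ≡⟨ solve 5 (λ v d u k e → v :* (d :+ u :* k :* e) := v :* d :+ k :* (u :* v :* e)) refl
         v (D 0 (+ k)) u (fromℕ k) E ⟩
  v * D 0 (+ k) + fromℕ k * (u * v * E)
    ≡⟨ cong₂ (λ x y → fromℕ (suc P ℕ.^ x) * D 0 (+ k) + fromℕ k * y) (sym (ℕₚ.+-identityʳ i)) (begin
         u * v * E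
           ≡⟨ cong (_* E) (fromℕ-* (suc P) (suc P ℕ.^ i)) ⟨
         fromℕ (suc P ℕ.^ suc i) * E
           ≡⟨ ev-dilate N P (D ∘ suc) (per ∘ suc) (suc i) k ⟩
         ev N (λ j k → fromℕ (suc P ℕ.^ suc (i ℕ.+ j)) * D (suc j) k) (+ k)
           ≡⟨ ev-cong N (+ k) (λ j → cong (λ x → fromℕ (suc P ℕ.^ x) * D (suc j) (+ k)) (sym (ℕₚ.+-suc i j))) ⟩
         ev N (λ j k → fromℕ (suc P ℕ.^ (i ℕ.+ suc j)) * D (suc j) k) (+ k) ∎) ⟩
  ev (suc N) (λ j k → fromℕ (suc P ℕ.^ (i ℕ.+ j)) * D j k) (+ k) ∎
  where
  open ≡-Reasoning
  u = fromℕ (suc P)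
  v = fromℕ (suc P ℕ.^ i)
  E = ev N (D ∘ suc) (+ (suc P ℕ.* k))
  D₀ : D 0 (+ (suc P ℕ.* k)) ≡ D 0 (+ k)
  D₀ = trans (cong (λ i → D 0 (+ (k ℕ.+ i))) (ℕₚ.*-comm P k)) (IsPeriod-multiple {D 0} k (per 0) (+ k))

-- Since (1 + P) k ≡ k mod P, the difference q ((1 + P) k) - q k has the
-- coefficients of q multiplied by the constants (1 + P) ^ j - 1; only the
-- constant coefficient is lost, and it is recovered at the end.
eventually-vanishing : ∀ N P C → 0 < P → (∀ j → IsPeriod (C j) P) → ∀ K →
                       (∀ k → K ≤ k → ev N C (+ k) ≡ 0ℚ) → ∀ j → j < N → ∀ k → C j k ≡ 0ℚ
eventually-vanishing (suc N) P C 0<P per K ev≡0 = λ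
  { zero    _         → C₀≡0
  ; (suc j) (s≤s j<N) → C⁺≡0 j j<N
  }
  where
  open ≡-Reasoning
  u = suc P
  D : Coeffs
  D j k = fromℕ (u ℕ.^ suc j) * C (suc j) k + - 1ℚ * C (suc j) k

  D-period : ∀ j → IsPeriod (D j) P
  D-period j k = cong (λ x → fromℕ (u ℕ.^ suc j) * x + - 1ℚ * x) (per (suc j) k)

  -- Once the constant coefficients cancel, a factor k remains; starting one later makes it nonzero.
  D-ev : ∀ k → suc K ≤ k → ev N D (+ k) ≡ 0ℚ
  D-ev k K<k = x*y≡0⇒y≡0 (fromℕ≢0 (ℕₚ.≤-trans (s≤s z≤n) K<k)) (begin
    fromℕ k * ev N D (+ k)
      ≡⟨ cong (fromℕ k *_) (ev-+* N _ _ (- 1ℚ) (+ k)) ⟩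
    fromℕ k * (ev N (λ j k → fromℕ (u ℕ.^ suc j) * C (suc j) k) (+ k) + - 1ℚ * ev N (C ∘ suc) (+ k))
      ≡⟨ cong (λ y → fromℕ k * (y + - 1ℚ * ev N (C ∘ suc) (+ k))) (ev-dilate N P (C ∘ suc) (per ∘ suc) 1 k) ⟨
    fromℕ k * (fromℕ (u ℕ.^ 1) * E + - 1ℚ * ev N (C ∘ suc) (+ k))
      ≡⟨ cong (λ y → fromℕ k * (fromℕ y * E + - 1ℚ * ev N (C ∘ suc) (+ k))) (ℕₚ.^-identityʳ u) ⟩
    fromℕ k * (fromℕ u * E + - 1ℚ * ev N (C ∘ suc) (+ k))
      ≡⟨ solve 5 (λ k u e d c → k :* (u :* e :+ con (- 1ℚ) :* d) := (c :+ u :* k :* e) :+ con (- 1ℚ) :* (c :+ k :* d)) refl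
           (fromℕ k) (fromℕ u) E (ev N (C ∘ suc) (+ k)) (C 0 (+ k)) ⟩
    (C 0 (+ k) + fromℕ u * fromℕ k * E) + - 1ℚ * ev (suc N) C (+ k)
      ≡⟨ cong₂ (λ x y → (x + y * E) + - 1ℚ * ev (suc N) C (+ k)) (sym C₀u) (sym (fromℕ-* u k)) ⟩
    ev (suc N) C (+ (u ℕ.* k)) + - 1ℚ * ev (suc N) C (+ k)
      ≡⟨ cong₂ (λ x y → x + - 1ℚ * y) (ev≡0 (u ℕ.* k) (ℕₚ.≤-trans K≤k (ℕₚ.m≤n*m k u))) (ev≡0 k K≤k) ⟩
    0ℚ ∎)
    where
    K≤k : K ≤ k
    K≤k = ℕₚ.<⇒≤ K<k
    E = ev N (C ∘ suc) (+ (u ℕ.* k))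
    C₀u : C 0 (+ (u ℕ.* k)) ≡ C 0 (+ k)
    C₀u = trans (cong (λ i → C 0 (+ (k ℕ.+ i))) (ℕₚ.*-comm P k)) (IsPeriod-multiple {C 0} k (per 0) (+ k))

  u^≢1 : ∀ j → fromℕ (u ℕ.^ suc j) + - 1ℚ ≢ 0ℚ
  u^≢1 j eq = ℕₚ.<⇒≢ (ℕₚ.<-≤-trans (s≤s 0<P) (ℕₚ.m≤m*n u (u ℕ.^ j) {{ℕₚ.m^n≢0 u j}}))
    (sym (ℤₚ.+-injective (fromℤ-injective (x-y≡0⇒x≡y {fromℕ (u ℕ.^ suc j)} {1ℚ} eq))))

  C⁺≡0 : ∀ j → j < N → ∀ k → C (suc j) k ≡ 0ℚ
  C⁺≡0 j j<N k = x*y≡0⇒y≡0 (u^≢1 j) (trans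
    (solve 2 (λ v c → (v :+ con (- 1ℚ)) :* c := v :* c :+ con (- 1ℚ) :* c) refl (fromℕ (u ℕ.^ suc j)) (C (suc j) k))
    (eventually-vanishing N P D 0<P D-period (suc K) D-ev j j<N k))

  C₀≡0 : ∀ k → C 0 k ≡ 0ℚ
  C₀≡0 = IsPeriod-eventually {C 0} 0<P (per 0) λ k K≤k → begin
    C 0 (+ k)                               ≡⟨ solve 2 (λ c k → c := c :+ k :* con 0ℚ) refl (C 0 (+ k)) (fromℕ k) ⟩
    C 0 (+ k) + fromℕ k * 0ℚ                ≡⟨ cong (λ y → C 0 (+ k) + fromℕ k * y)
                                                 (ev-vanishing N (C ∘ suc) (+ k) (λ j j<N → C⁺≡0 j j<N (+ k))) ⟨
    ev (suc N) C (+ k)                      ≡⟨ ev≡0 k K≤k ⟩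
    0ℚ                                      ∎

-- Backward differences of periodic functions.

-- An m-periodic increment over m makes `c` grow linearly along steps of size m. After P such steps
-- the argument has moved by a multiple of P and `c` is back at its initial value, so the increment
-- is zero.
no-drift : ∀ {c P m} → 0 < P → IsPeriod c P → IsPeriod (λ k → c (k ℤ.+ + m) + - 1ℚ * c k) m → IsPeriod c m
no-drift {c} {P} {m} 0<P c-per g-per k = begin
  c (k ℤ.+ + m)      ≡⟨ solve 2 (λ a b → a := b :+ (a :+ con (- 1ℚ) :* b)) refl (c (k ℤ.+ + m)) (c k) ⟩
  c k + g k          ≡⟨ cong (λ y → c k + y) g≡0 ⟩
  c k + 0ℚ           ≡⟨ ℚₚ.+-identityʳ (c k) ⟩
  c k                ∎
  where
  open ≡-Reasoning
  g : ℤ → ℚ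
  g k = c (k ℤ.+ + m) + - 1ℚ * c k
  h : ℕ → ℚ
  h t = c (k ℤ.+ + (t ℕ.* m))
  step : ∀ t → h (suc t) ≡ h t + g k
  step t = begin
    c (k ℤ.+ + (m ℕ.+ t ℕ.* m))       ≡⟨ cong (λ i → c (k ℤ.+ + i)) (ℕₚ.+-comm m (t ℕ.* m)) ⟩
    c (k ℤ.+ + (t ℕ.* m ℕ.+ m))       ≡⟨ cong c (ℤₚ.+-assoc k (+ (t ℕ.* m)) (+ m)) ⟨
    c (k ℤ.+ + (t ℕ.* m) ℤ.+ + m)     ≡⟨ solve 2 (λ a b → a := b :+ (a :+ con (- 1ℚ) :* b)) refl _ (h t) ⟩
    h t + g (k ℤ.+ + (t ℕ.* m))       ≡⟨ cong (λ y → h t + y) (IsPeriod-multiple {g} t g-per k) ⟩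
    h t + g k                         ∎
  h0≡c : h 0 ≡ c k
  h0≡c = cong c (ℤₚ.+-identityʳ k)
  hP≡c : h P ≡ c k
  hP≡c = trans (cong (λ i → c (k ℤ.+ + i)) (ℕₚ.*-comm P m)) (IsPeriod-multiple {c} m c-per k)
  g≡0 : g k ≡ 0ℚ
  g≡0 = x*y≡0⇒y≡0 (fromℕ≢0 0<P) (begin
    fromℕ P * g k                 ≡⟨ solve 2 (λ a b → b := (a :+ b) :+ con (- 1ℚ) :* a) refl (h 0) (fromℕ P * g k) ⟩
    h 0 + fromℕ P * g k + - 1ℚ * h 0 ≡⟨ cong (_+ - 1ℚ * h 0) (linear-drift h (g k) P (λ t _ → step t)) ⟨
    h P + - 1ℚ * h 0              ≡⟨ cong₂ (λ x y → x + - 1ℚ * y) hP≡c h0≡c ⟩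
    c k + - 1ℚ * c k              ≡⟨ solve 1 (λ a → a :+ con (- 1ℚ) :* a := con 0ℚ) refl (c k) ⟩
    0ℚ                            ∎)

backward-difference : ℕ → (ℤ → ℚ) → ℤ → ℚ
backward-difference s c k = c k + - 1ℚ * c (k ℤ.+ ℤ.- + s)

-- Let g be the increment of `c` over m. Periodicity of the difference says that g is unchanged by a
-- shift of s; as s divides m, g also has period m, and `no-drift` applies.
difference-period : ∀ {c P s m} → 0 < P → IsPeriod c P → s ∣ m → IsPeriod (backward-difference s c) m → IsPeriod c m
difference-period {c} {P} {s} {m} 0<P c-per s∣m d-per = no-drift {c} 0<P c-per (IsPeriod-∣ {g} s∣m g-per)
  where
  open ≡-Reasoning
  g : ℤ → ℚ
  g k = c (k ℤ.+ + m) + - 1ℚ * c k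
  g-back : ∀ k → g k ≡ g (k ℤ.+ ℤ.- + s)
  g-back k = begin
    a + - 1ℚ * b
      ≡⟨ solve 3 (λ a b x → a :+ con (- 1ℚ) :* b := (a :+ con (- 1ℚ) :* x) :+ con (- 1ℚ) :* b :+ x) refl
           a b (c (k ℤ.+ + m ℤ.+ ℤ.- + s)) ⟩
    backward-difference s c (k ℤ.+ + m) + - 1ℚ * b + c (k ℤ.+ + m ℤ.+ ℤ.- + s)
      ≡⟨ cong₂ (λ x y → x + - 1ℚ * b + c y) (d-per k) (xy∙z≈xz∙y k (+ m) (ℤ.- + s)) ⟩
    (b + - 1ℚ * y) + - 1ℚ * b + c (k ℤ.+ ℤ.- + s ℤ.+ + m)
      ≡⟨ solve 3 (λ b y z → (b :+ con (- 1ℚ) :* y) :+ con (- 1ℚ) :* b :+ z := z :+ con (- 1ℚ) :* y) refl b y _ ⟩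
    c (k ℤ.+ ℤ.- + s ℤ.+ + m) + - 1ℚ * y ∎
    where
    a = c (k ℤ.+ + m)
    b = c k
    y = c (k ℤ.+ ℤ.- + s)
  g-per : IsPeriod g s
  g-per k = trans (g-back (k ℤ.+ + s)) (cong g (i+j-j≡i k (+ s)))

-- Generating functions ∏ 1 / (1 - z ^ s)

delay : ℕ → (ℕ → ℚ) → ℕ → ℚ
delay zero    f k       = f k
delay (suc s) f zero    = 0ℚ
delay (suc s) f (suc k) = delay s f k

-- The product of the generating function of f with 1 - z ^ s.
∇ : ℕ → (ℕ → ℚ) → ℕ → ℚ
∇ s f k = f k + - 1ℚ * delay s f k

unit : ℕ → ℚ
unit zero    = 1ℚ
unit (suc k) = 0ℚ

-- f k is the coefficient of z ^ k in ∏ 1 / (1 - z ^ s), s ranging over ss.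
HasDenominator : List ℕ → (ℕ → ℚ) → Set
HasDenominator []       f = ∀ k → f k ≡ unit k
HasDenominator (s ∷ ss) f = HasDenominator ss (∇ s f)

delay-cong : ∀ s {f g} → (∀ k → f k ≡ g k) → ∀ k → delay s f k ≡ delay s g k
delay-cong zero    eq k       = eq k
delay-cong (suc s) eq zero    = refl
delay-cong (suc s) eq (suc k) = delay-cong s eq k

∇-cong : ∀ s {f g} → (∀ k → f k ≡ g k) → ∀ k → ∇ s f k ≡ ∇ s g k
∇-cong s eq k = cong₂ (λ x y → x + - 1ℚ * y) (eq k) (delay-cong s eq k)

delay-+ : ∀ s f k → delay s f (s ℕ.+ k) ≡ f k
delay-+ zero    f k = refl
delay-+ (suc s) f k = delay-+ s f k

delay-< : ∀ s f k → k < s → delay s f k ≡ 0ℚ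
delay-< (suc s) f zero    _         = refl
delay-< (suc s) f (suc k) (s≤s k<s) = delay-< s f k k<s

delay-delay : ∀ s t f k → delay s (delay t f) k ≡ delay (s ℕ.+ t) f k
delay-delay zero    t f k       = refl
delay-delay (suc s) t f zero    = refl
delay-delay (suc s) t f (suc k) = delay-delay s t f k

delay-+* : ∀ s f g x k → delay s (λ k → f k + x * g k) k ≡ delay s f k + x * delay s g k
delay-+* zero    f g x k       = refl
delay-+* (suc s) f g x zero    = solve 1 (λ x → con 0ℚ := con 0ℚ :+ x :* con 0ℚ) refl x
delay-+* (suc s) f g x (suc k) = delay-+* s f g x k

∇-comm : ∀ s t f k → ∇ s (∇ t f) k ≡ ∇ t (∇ s f) k
∇-comm s t f k = begin
  ∇ t f k + - 1ℚ * delay s (∇ t f) k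
    ≡⟨ cong (λ y → ∇ t f k + - 1ℚ * y) (delay-+* s f (delay t f) (- 1ℚ) k) ⟩
  f k + - 1ℚ * delay t f k + - 1ℚ * (delay s f k + - 1ℚ * delay s (delay t f) k)
    ≡⟨ cong (λ y → f k + - 1ℚ * delay t f k + - 1ℚ * (delay s f k + - 1ℚ * y))
         (trans (delay-delay s t f k) (trans (cong (λ n → delay n f k) (ℕₚ.+-comm s t)) (sym (delay-delay t s f k)))) ⟩
  f k + - 1ℚ * delay t f k + - 1ℚ * (delay s f k + - 1ℚ * delay t (delay s f) k)
    ≡⟨ solve 4 (λ f t s u → f :+ con (- 1ℚ) :* t :+ con (- 1ℚ) :* (s :+ con (- 1ℚ) :* u) :=
                            f :+ con (- 1ℚ) :* s :+ con (- 1ℚ) :* (t :+ con (- 1ℚ) :* u)) refl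
         (f k) (delay t f k) (delay s f k) (delay t (delay s f) k) ⟩
  f k + - 1ℚ * delay s f k + - 1ℚ * (delay t f k + - 1ℚ * delay t (delay s f) k)
    ≡⟨ cong (λ y → ∇ s f k + - 1ℚ * y) (delay-+* t f (delay s f) (- 1ℚ) k) ⟨
  ∇ s f k + - 1ℚ * delay t (∇ s f) k ∎
  where open ≡-Reasoning

HasDenominator-cong : ∀ ss {f g} → (∀ k → f k ≡ g k) → HasDenominator ss f → HasDenominator ss g
HasDenominator-cong []       eq den k = trans (sym (eq k)) (den k)
HasDenominator-cong (s ∷ ss) eq den   = HasDenominator-cong ss (∇-cong s eq) den

HasDenominator-↭ : ∀ {ss ts} f → ss ↭ ts → HasDenominator ss f → HasDenominator ts f
HasDenominator-↭ f Perm.refl den = den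
HasDenominator-↭ f (Perm.prep s p) den = HasDenominator-↭ (∇ s f) p den
HasDenominator-↭ f (Perm.swap {ss} {ts} s t p) den =
  HasDenominator-cong ts (∇-comm t s f) (HasDenominator-↭ (∇ t (∇ s f)) p den)
HasDenominator-↭ f (Perm.trans p q) den = HasDenominator-↭ f q (HasDenominator-↭ f p den)

-- The coefficients of the quasi-polynomial k ↦ q k - q (k - s).
difference : ℕ → ℕ → Coeffs → Coeffs
difference s N C j k = C j k + - 1ℚ * translate (ℤ.- + s) N C j k

-- The period arguments rest on this identity: the difference of a coefficient and the coefficient
-- of the difference are separated only by a carry from above j.
difference-expand : ∀ s N C j k →
  backward-difference s (C j) k ≡ difference s N C j k + carry (ℤ.- + s) N C j k
difference-expand s N C j k =
  solve 3 (λ c t r → c :+ con (- 1ℚ) :* t := (c :+ con (- 1ℚ) :* (t :+ r)) :+ r) refl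
    (C j k) (C j (k ℤ.+ ℤ.- + s)) (carry (ℤ.- + s) N C j k)

difference-vanishes : ∀ s N {C} → VanishesFrom N C → VanishesFrom N (difference s N C)
difference-vanishes s N C≡0 j N≤j k =
  cong₂ (λ x y → x + - 1ℚ * y) (C≡0 j N≤j k) (translate-vanishes (ℤ.- + s) N C≡0 j N≤j k)

difference-periodic : ∀ s N C P → (∀ j → IsPeriod (C j) P) → ∀ j → IsPeriod (difference s N C j) P
difference-periodic s N C P per j =
  +∈ (per j) (*∈ (- 1ℚ) (+∈ (shift∈ (ℤ.- + s) (per j)) (carry∈ (IsPeriod-subspace P) (ℤ.- + s) N C j (λ i _ → per i))))
  where open Subspace (IsPeriod-subspace P)

ev-difference : ∀ s N C → VanishesFrom N C → ∀ k →
                ev N (difference s N C) k ≡ ev N C k + - 1ℚ * ev N C (k ℤ.+ ℤ.- + s)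
ev-difference s N C C≡0 k = trans (ev-+* N C (translate (ℤ.- + s) N C) (- 1ℚ) k)
  (cong (λ y → ev N C k + - 1ℚ * y) (ev-translate (ℤ.- + s) N C≡0 k))

ev-difference-+ : ∀ s N C → VanishesFrom N C → ∀ k →
                  ev N (difference s N C) (+ (s ℕ.+ k)) ≡ ev N C (+ (s ℕ.+ k)) + - 1ℚ * ev N C (+ k)
ev-difference-+ s N C C≡0 k = trans (ev-difference s N C C≡0 (+ (s ℕ.+ k)))
  (cong (λ i → ev N C (+ (s ℕ.+ k)) + - 1ℚ * ev N C i) (begin
    + (s ℕ.+ k) ℤ.+ ℤ.- + s     ≡⟨ cong (λ i → + i ℤ.+ ℤ.- + s) (ℕₚ.+-comm s k) ⟩
    + k ℤ.+ + s ℤ.+ ℤ.- + s     ≡⟨ i+j-j≡i (+ k) (+ s) ⟩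
    + k                         ∎))
  where open ≡-Reasoning

∇-+ : ∀ s f k → ∇ s f (s ℕ.+ k) ≡ f (s ℕ.+ k) + - 1ℚ * f k
∇-+ s f k = cong (λ y → f (s ℕ.+ k) + - 1ℚ * y) (delay-+ s f k)

-- Quasi-polynomials that represent a sequence.

-- Agreement starts at a threshold because `delay` cuts a sequence off to zero at negative arguments
-- and a quasi-polynomial does not, so that each `∇ s` may cost s further arguments.
record Represents (N : ℕ) (C : Coeffs) (P K : ℕ) (f : ℕ → ℚ) : Set where
  field
    bounded    : VanishesFrom N C
    P>0        : 0 < P
    period     : ∀ j → IsPeriod (C j) P
    eventually : ∀ k → K ≤ k → ev N C (+ k) ≡ f k

Represents-∇ : ∀ {N C P K f} s → Represents N C P K f → Represents N (difference s N C) P (s ℕ.+ K) (∇ s f)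
Represents-∇ {N} {C} {P} {K} {f} s r = record
  { bounded    = difference-vanishes s N bounded
  ; P>0        = P>0
  ; period     = difference-periodic s N C P period
  ; eventually = λ k s+K≤k → subst (λ k → ev N (difference s N C) (+ k) ≡ ∇ s f k)
      (ℕₚ.m+[n∸m]≡n (ℕₚ.≤-trans (ℕₚ.m≤m+n s K) s+K≤k)) (begin
        ev N (difference s N C) (+ (s ℕ.+ (k ℕ.∸ s)))
          ≡⟨ ev-difference-+ s N C bounded (k ℕ.∸ s) ⟩
        ev N C (+ (s ℕ.+ (k ℕ.∸ s))) + - 1ℚ * ev N C (+ (k ℕ.∸ s))
          ≡⟨ cong₂ (λ x y → x + - 1ℚ * y) (eventually _ (ℕₚ.≤-trans (K≤k∸s k s+K≤k) (ℕₚ.m≤n+m _ s)))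
               (eventually _ (K≤k∸s k s+K≤k)) ⟩
        f (s ℕ.+ (k ℕ.∸ s)) + - 1ℚ * f (k ℕ.∸ s)
          ≡⟨ ∇-+ s f (k ℕ.∸ s) ⟨
        ∇ s f (s ℕ.+ (k ℕ.∸ s)) ∎)
  }
  where
  open Represents r
  open ≡-Reasoning
  K≤k∸s : ∀ k → s ℕ.+ K ≤ k → K ≤ k ℕ.∸ s
  K≤k∸s k s+K≤k = ℕₚ.m+n≤o⇒m≤o∸n K (subst (_≤ k) (ℕₚ.+-comm s K) s+K≤k)

unit-vanishes : ∀ {N C P K f} → Represents N C P K f → (∀ k → f k ≡ unit k) → ∀ j k → C j k ≡ 0ℚ
unit-vanishes {N} {C} {P} {K} {f} r f≡unit j k with ℕₚ.<-≤-connex j N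
... | inj₂ N≤j = Represents.bounded r j N≤j k
-- The threshold is raised by one to exclude 0, where `unit` is 1.
... | inj₁ j<N = eventually-vanishing N P C P>0 period (suc K) ev≡0 j j<N k
  where
  open Represents r
  ev≡0 : ∀ k → suc K ≤ k → ev N C (+ k) ≡ 0ℚ
  ev≡0 (suc k) (s≤s K≤k) = trans (eventually (suc k) (ℕₚ.m≤n⇒m≤1+n K≤k)) (f≡unit (suc k))

-- A step of size s ≥ 1 in q k = q (k + s) - (∇ q) (k + s) reaches k = 0 as
-- soon as ∇ q is known on positive arguments.
agreement-step : ∀ {N C P K f} s → 0 < s → Represents N C P K f →
                 (∀ k → ev N (difference s N C) (+ suc k) ≡ ∇ s f (suc k)) → ∀ k → ev N C (+ k) ≡ f k
-- As s ≥ 1, K steps of size s lead past the threshold K.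
agreement-step {N} {C} {P} {K} {f} s@(suc s-1) _ r eq k = descend K k (ℕₚ.≤-trans (ℕₚ.m≤n*m K s) (ℕₚ.m≤m+n _ k))
  where
  open Represents r
  open ≡-Reasoning
  step : ∀ k → ev N C (+ (s ℕ.+ k)) ≡ f (s ℕ.+ k) → ev N C (+ k) ≡ f k
  step k h = begin
    ev N C (+ k)
      ≡⟨ solve 2 (λ a b → b := a :+ con (- 1ℚ) :* (a :+ con (- 1ℚ) :* b)) refl (ev N C (+ (s ℕ.+ k))) (ev N C (+ k)) ⟩
    ev N C (+ (s ℕ.+ k)) + - 1ℚ * (ev N C (+ (s ℕ.+ k)) + - 1ℚ * ev N C (+ k))
      ≡⟨ cong₂ (λ x y → x + - 1ℚ * y) h (trans (sym (ev-difference-+ s N C bounded k)) (trans (eq (s-1 ℕ.+ k)) (∇-+ s f k))) ⟩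
    f (s ℕ.+ k) + - 1ℚ * (f (s ℕ.+ k) + - 1ℚ * f k)
      ≡⟨ solve 2 (λ a b → a :+ con (- 1ℚ) :* (a :+ con (- 1ℚ) :* b) := b) refl (f (s ℕ.+ k)) (f k) ⟩
    f k ∎
  descend : ∀ t k → K ≤ s ℕ.* t ℕ.+ k → ev N C (+ k) ≡ f k
  descend zero    k K≤k = eventually k (subst (λ i → K ≤ i ℕ.+ k) (ℕₚ.*-zeroʳ s) K≤k)
  descend (suc t) k K≤  = step k (descend t (s ℕ.+ k) (subst (K ≤_) (begin
    s ℕ.* suc t ℕ.+ k        ≡⟨ cong (ℕ._+ k) (trans (ℕₚ.*-suc s t) (ℕₚ.+-comm s _)) ⟩
    s ℕ.* t ℕ.+ s ℕ.+ k      ≡⟨ ℕₚ.+-assoc (s ℕ.* t) s k ⟩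
    s ℕ.* t ℕ.+ (s ℕ.+ k)    ∎) K≤))

-- Restricted to positive arguments, since with no factor left the quasi-polynomial is 0 everywhere
-- while `unit 0` is 1.
agreement⁺ : ∀ {N C P K f} ss → All (0 <_) ss → Represents N C P K f → HasDenominator ss f →
             ∀ k → ev N C (+ suc k) ≡ f (suc k)
agreement⁺ {N} {C} [] _ r den k = trans (ev-vanishing N C (+ suc k) (λ j _ → unit-vanishes r den j (+ suc k))) (sym (den (suc k)))
agreement⁺ (s ∷ ss) (s>0 ∷ ss>0) r den k = agreement-step s s>0 r (agreement⁺ ss ss>0 (Represents-∇ s r) den) (suc k)

agreement : ∀ {N C P K f} s ss → All (0 <_) (s ∷ ss) → Represents N C P K f → HasDenominator (s ∷ ss) f →
            ∀ k → ev N C (+ k) ≡ f k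
agreement s ss (s>0 ∷ ss>0) r den = agreement-step s s>0 r (agreement⁺ ss ss>0 (Represents-∇ s r) den)

-- Coefficient functions for a divisibility chain

IsPeriod-cong : ∀ {c d p} → (∀ k → c k ≡ d k) → IsPeriod d p → IsPeriod c p
IsPeriod-cong eq per k = trans (eq _) (trans (per k) (sym (eq k)))

-- Carries come only from higher coefficients, and these vanish from some index on; properties
-- therefore spread from there downwards.
downward : (W : ℕ → Set) → ∀ N → (∀ j → N ≤ j → W j) → (∀ j → (∀ i → j < i → W i) → W j) → ∀ j → W j
downward W zero    W≥N step j = W≥N j z≤n
downward W (suc N) W>N step   = downward W N (λ j N≤j → step j (λ i j<i → W>N i (ℕₚ.≤-<-trans N≤j j<i))) step

chain-∣ : ∀ {s : ℕ → ℕ} {N} → (∀ i → suc i < N → s (suc i) ∣ s i) → ∀ {i j} → j ≤ i → i < N → s i ∣ s j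
chain-∣ {s} {N} div {i} {j} j≤i i<N = subst (λ i → s i ∣ s j) (ℕₚ.m∸n+n≡m j≤i)
  (go (i ℕ.∸ j) (subst (_< N) (sym (ℕₚ.m∸n+n≡m j≤i)) i<N))
  where
  go : ∀ t → t ℕ.+ j < N → s (t ℕ.+ j) ∣ s j
  go zero    _   = ∣-refl
  go (suc t) t<N = ∣-trans (div (t ℕ.+ j) t<N) (go t (ℕₚ.<⇒≤ t<N))

-- Together with `periods`, the fields `support` and `nonzero` make the top coefficient, on
-- nonnegative arguments, a nonzero constant times the indicator of the multiples of the smallest s.
record Structure (s : ℕ → ℕ) (N : ℕ) (C : Coeffs) : Set where
  field
    vanishes : VanishesFrom N C
    periods  : ∀ j → j < N → IsPeriod (C j) (s j)
    support  : ∀ n → N ≡ suc n → ∀ k → ¬ s n ∣ k → C n (+ k) ≡ 0ℚ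
    nonzero  : ∀ n → N ≡ suc n → C n (+ 0) ≢ 0ℚ
    -- Stronger than the failure of all periods p < s j: it has to survive the
    -- carries from the higher coefficients, whose periods divide s (suc j).
    indecomposable : ∀ j → j < N → ∀ p m g u → 0 < p → p < s j → 0 < m → m < s j →
                     (suc j < N → s (suc j) ∣ m) → IsPeriod g p → IsPeriod u m →
                     (∀ k → C j k ≡ g k + u k) → ⊥

-- Adding one smaller term to the chain.

module StructureStep
  (s : ℕ → ℕ) (N : ℕ) (pos : ∀ i → i < suc N → 0 < s i) (div : ∀ i → suc i < suc N → s (suc i) ∣ s i)
  {N′ : ℕ} {C : Coeffs} {P K : ℕ} {f : ℕ → ℚ} (r : Represents N′ C P K f)
  (den : HasDenominator (applyDownFrom s (suc N)) f)
  (IH : Structure s N (difference (s N) N′ C))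
  where

  private
    open Represents r
    open ≡-Reasoning
    σ = s N
    σ>0 : 0 < σ
    σ>0 = pos N ℕₚ.≤-refl
    D : Coeffs
    D = difference σ N′ C
    module IH = Structure IH

    s∣s : ∀ {i j} → j ≤ i → i ≤ N → s i ∣ s j
    s∣s j≤i i≤N = chain-∣ {s} div j≤i (s≤s i≤N)

    D-period : ∀ j → IsPeriod (D j) (s (j ℕ.⊓ N))
    D-period j with ℕₚ.<-≤-connex j N
    ... | inj₁ j<N = subst (λ i → IsPeriod (D j) (s i)) (sym (ℕₚ.m≤n⇒m⊓n≡m (ℕₚ.<⇒≤ j<N))) (IH.periods j j<N)
    ... | inj₂ N≤j = λ k → trans (IH.vanishes j N≤j _) (sym (IH.vanishes j N≤j k))

    -- Each contribution to the backward difference of C j, from `D` or from a carry, has a period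
    -- dividing s (j ⊓ N), which is a multiple of σ; so `difference-period` applies. The minimum
    -- assigns period σ to all indices from N on, and `vanish` starts from that.
    W : ∀ j → IsPeriod (C j) (s (j ℕ.⊓ N))
    W = downward _ N′ (λ j N′≤j k → trans (bounded j N′≤j _) (sym (bounded j N′≤j k))) λ j Wi →
      difference-period P>0 (period j) (s∣s (ℕₚ.m⊓n≤n j N) ℕₚ.≤-refl)
        (IsPeriod-cong (difference-expand σ N′ C j) (Subspace.+∈ (IsPeriod-subspace _) (D-period j)
          (carry∈ (IsPeriod-subspace _) (ℤ.- + σ) N′ C j λ i j<i →
            IsPeriod-∣ {C i} (s∣s (ℕₚ.⊓-monoˡ-≤ N (ℕₚ.<⇒≤ j<i)) (ℕₚ.m⊓n≤n i N)) (Wi i j<i))))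

    σ-period : ∀ j → N ≤ j → IsPeriod (C j) σ
    σ-period j N≤j = subst (λ i → IsPeriod (C j) (s i)) (ℕₚ.m≥n⇒m⊓n≡n N≤j) (W j)

    cancel : ∀ j x → fromℕ (suc j) * (fromℤ (ℤ.- + σ) * x) ≡ 0ℚ → x ≡ 0ℚ
    cancel j x eq = x*y≡0⇒y≡0 (fromℤ≢0 λ -σ≡0 → ℕₚ.<⇒≢ σ>0 (sym (ℤₚ.+-injective
      (trans (sym (ℤₚ.neg-involutive (+ σ))) (cong ℤ.-_ -σ≡0)))))
      (x*y≡0⇒y≡0 (fromℕ≢0 {suc j} (s≤s z≤n)) eq)

    -- For j ≥ N, C j has period σ and D j is zero, so the carry into degree j is zero as well. Once
    -- the coefficients above j + 1 are known to vanish, that carry is a nonzero multiple of C (j +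
    -- 1).
    vanish : ∀ j → suc N ≤ j → ∀ k → C j k ≡ 0ℚ
    vanish = downward (λ j → suc N ≤ j → ∀ k → C j k ≡ 0ℚ) N′ (λ j N′≤j _ → bounded j N′≤j)
      λ { zero _ () ; (suc j) C≡0 (s≤s N≤j) k → trans (sym (IsPeriod-back {C (suc j)} (σ-period (suc j) (ℕₚ.m≤n⇒m≤1+n N≤j)) k))
        (cancel j _ (begin
          fromℕ (suc j) * (fromℤ (ℤ.- + σ) * C (suc j) (k ℤ.+ ℤ.- + σ))
            ≡⟨ carry-leading (ℤ.- + σ) N′ bounded j (λ i j<i → C≡0 i j<i (ℕₚ.≤-trans (s≤s N≤j) (ℕₚ.<⇒≤ j<i))) k ⟨
          carry (ℤ.- + σ) N′ C j k
            ≡⟨ solve 1 (λ x → x := con 0ℚ :+ x) refl _ ⟩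
          0ℚ + carry (ℤ.- + σ) N′ C j k
            ≡⟨ cong (_+ carry (ℤ.- + σ) N′ C j k) (IH.vanishes j N≤j k) ⟨
          D j k + carry (ℤ.- + σ) N′ C j k
            ≡⟨ difference-expand σ N′ C j k ⟨
          C j k + - 1ℚ * C j (k ℤ.+ ℤ.- + σ)
            ≡⟨ cong (λ y → C j k + - 1ℚ * y) (IsPeriod-back {C j} (σ-period j N≤j) k) ⟩
          C j k + - 1ℚ * C j k
            ≡⟨ solve 1 (λ x → x :+ con (- 1ℚ) :* x := con 0ℚ) refl (C j k) ⟩
          0ℚ ∎)) }

    -- For N = 0, C 0 agrees with f, which is the indicator of σ ∣ k.
    module Base (N≡0 : N ≡ 0) where
      ev≡C₀ : ∀ n → VanishesFrom n C → ∀ k → ev n C k ≡ C 0 k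
      ev≡C₀ zero    C≡0 k = sym (C≡0 0 z≤n k)
      ev≡C₀ (suc n) C≡0 k = trans
        (cong (λ y → C 0 k + fromℤ k * y) (ev-vanishing n (C ∘ suc) k
          (λ j _ → vanish (suc j) (s≤s (ℕₚ.≤-trans (ℕₚ.≤-reflexive N≡0) z≤n)) k)))
        (solve 2 (λ c k → c :+ k :* con 0ℚ := c) refl (C 0 k) (fromℤ k))
      den′ : HasDenominator (σ ∷ []) f
      den′ = subst (λ n → HasDenominator (σ ∷ applyDownFrom s n) f) N≡0 den
      C₀-< : ∀ k → k < σ → C 0 (+ k) ≡ unit k
      C₀-< k k<σ = begin
        C 0 (+ k)                ≡⟨ ev≡C₀ N′ bounded (+ k) ⟨
        ev N′ C (+ k)            ≡⟨ agreement σ [] (σ>0 ∷ []) r den′ k ⟩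
        f k                      ≡⟨ solve 1 (λ x → x := x :+ con (- 1ℚ) :* con 0ℚ) refl (f k) ⟩
        f k + - 1ℚ * 0ℚ          ≡⟨ cong (λ y → f k + - 1ℚ * y) (delay-< σ f k k<σ) ⟨
        ∇ σ f k                  ≡⟨ den′ k ⟩
        unit k                   ∎
      support₀ : ∀ k → ¬ σ ∣ k → C 0 (+ k) ≡ 0ℚ
      support₀ k σ∤k = begin
        C 0 (+ k)                              ≡⟨ cong (λ i → C 0 (+ i)) (m≡m%n+[m/n]*n k σ) ⟩
        C 0 (+ (k % σ ℕ.+ k / σ ℕ.* σ))        ≡⟨ IsPeriod-multiple {C 0} (k / σ) (σ-period 0 (ℕₚ.≤-reflexive N≡0)) (+ (k % σ)) ⟩
        C 0 (+ (k % σ))                        ≡⟨ C₀-< (k % σ) (m%n<n k σ) ⟩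
        unit (k % σ)                           ≡⟨ unit≡0 (k % σ) (σ∤k ∘ m%n≡0⇒n∣m k σ) ⟩
        0ℚ                                     ∎
        where
        instance _ = ℕ.>-nonZero σ>0
        unit≡0 : ∀ k → k ≢ 0 → unit k ≡ 0ℚ
        unit≡0 zero    k≢0 = contradiction refl k≢0
        unit≡0 (suc k) _   = refl

    -- Summing D n (k + t σ) over one period s n = M σ of C n leaves M times the
    -- carry, a nonzero multiple of C (suc n) k.
    module Telescope {n} (N≡ : N ≡ suc n) (k : ℕ) where
      c : ℚ
      c = C (suc n) (+ k)
      x : ℚ
      x = fromℕ (suc n) * (fromℤ (ℤ.- + σ) * c)
      σ∣sn : σ ∣ s n
      σ∣sn = s∣s (ℕₚ.≤-trans (ℕₚ.n≤1+n n) (ℕₚ.≤-reflexive (sym N≡))) ℕₚ.≤-refl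
      n<N : n < N
      n<N = ℕₚ.≤-reflexive (sym N≡)
      M = _∣_.quotient σ∣sn
      h : ℕ → ℚ
      h t = C n (+ (k ℕ.+ t ℕ.* σ))
      C⁺-period : IsPeriod (C (suc n)) σ
      C⁺-period = σ-period (suc n) (ℕₚ.≤-reflexive N≡)
      h-step : ∀ t → h (suc t) ≡ h t + (D n (+ (k ℕ.+ suc t ℕ.* σ)) + x)
      h-step t = begin
        h (suc t)
          ≡⟨ solve 2 (λ a b → a := b :+ (a :+ con (- 1ℚ) :* b)) refl (h (suc t)) (h t) ⟩
        h t + (h (suc t) + - 1ℚ * h t)
          ≡⟨ cong (λ i → h t + (h (suc t) + - 1ℚ * C n i)) back ⟨
        h t + backward-difference σ (C n) (+ k⁺)
          ≡⟨ cong (λ y → h t + y) (difference-expand σ N′ C n (+ k⁺)) ⟩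
        h t + (D n (+ k⁺) + carry (ℤ.- + σ) N′ C n (+ k⁺))
          ≡⟨ cong (λ y → h t + (D n (+ k⁺) + y)) (carry-leading (ℤ.- + σ) N′ bounded n
               (λ j j≥ → vanish j (subst (λ i → suc i ≤ j) (sym N≡) j≥)) (+ k⁺)) ⟩
        h t + (D n (+ k⁺) + fromℕ (suc n) * (fromℤ (ℤ.- + σ) * C (suc n) (+ k⁺ ℤ.+ ℤ.- + σ)))
          ≡⟨ cong (λ y → h t + (D n (+ k⁺) + fromℕ (suc n) * (fromℤ (ℤ.- + σ) * y)))
               (trans (cong (C (suc n)) back) (IsPeriod-multiple {C (suc n)} t C⁺-period (+ k))) ⟩
        h t + (D n (+ k⁺) + x) ∎
        where
        k⁺ = k ℕ.+ suc t ℕ.* σ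
        back : + k⁺ ℤ.+ ℤ.- + σ ≡ + (k ℕ.+ t ℕ.* σ)
        back = begin
          + (k ℕ.+ (σ ℕ.+ t ℕ.* σ)) ℤ.+ ℤ.- + σ
            ≡⟨ cong (λ i → + i ℤ.+ ℤ.- + σ) (trans (cong (λ i → k ℕ.+ i) (ℕₚ.+-comm σ _)) (sym (ℕₚ.+-assoc k _ σ))) ⟩
          + (k ℕ.+ t ℕ.* σ) ℤ.+ + σ ℤ.+ ℤ.- + σ
            ≡⟨ i+j-j≡i (+ (k ℕ.+ t ℕ.* σ)) (+ σ) ⟩
          + (k ℕ.+ t ℕ.* σ) ∎
      Mσ≡sn : M ℕ.* σ ≡ s n
      Mσ≡sn = sym (_∣_.equality σ∣sn)
      M>0 : 0 < M
      M>0 = ℕₚ.n≢0⇒n>0 λ M≡0 → ℕₚ.<⇒≢ (pos n (ℕₚ.m<n⇒m<1+n n<N)) (trans (sym (cong (ℕ._* σ) M≡0)) Mσ≡sn)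
      hM≡h0 : h M ≡ h 0
      hM≡h0 = begin
        C n (+ (k ℕ.+ M ℕ.* σ))  ≡⟨ cong (λ i → C n (+ (k ℕ.+ i))) Mσ≡sn ⟩
        C n (+ k ℤ.+ + s n)      ≡⟨ subst (λ i → IsPeriod (C n) (s i)) (ℕₚ.m≤n⇒m⊓n≡m (ℕₚ.<⇒≤ n<N)) (W n) (+ k) ⟩
        C n (+ k)                ≡⟨ cong (λ i → C n (+ i)) (ℕₚ.+-identityʳ k) ⟨
        h 0                      ∎

      drift : ∀ t → (∀ i → i < t → D n (+ (k ℕ.+ suc i ℕ.* σ)) ≡ 0ℚ) → h t ≡ h 0 + fromℕ t * x
      drift t D≡0 = linear-drift h x t λ i i<t → trans (h-step i)
        (cong (λ y → h i + y) (trans (cong (_+ x) (D≡0 i i<t)) (ℚₚ.+-identityˡ x)))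

    -- As σ divides s n, a k that is not a multiple of σ has no k + i σ divisible by s n. All values
    -- of `D` in the telescoping sum are then zero, leaving M x = 0.
    support : ∀ n → n ≡ N → Structure s n D → ∀ k → ¬ s n ∣ k → C n (+ k) ≡ 0ℚ
    support zero    refl _   = Base.support₀ refl
    support (suc n) refl str k σ∤k = cancel n c (x*y≡0⇒y≡0 (fromℕ≢0 M>0) (begin
      fromℕ M * x              ≡⟨ solve 2 (λ a b → b := (a :+ b) :+ con (- 1ℚ) :* a) refl (h 0) (fromℕ M * x) ⟩
      h 0 + fromℕ M * x + - 1ℚ * h 0
                               ≡⟨ cong (_+ - 1ℚ * h 0) (trans (sym (drift M λ i _ → Structure.support str n refl _
                                    λ sn∣ → σ∤k (∣m+n∣m⇒∣n (subst (σ ∣_) (ℕₚ.+-comm k _) (∣-trans σ∣sn sn∣)) (n∣m*n (suc i))))) hM≡h0) ⟩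
      h 0 + - 1ℚ * h 0         ≡⟨ solve 1 (λ a → a :+ con (- 1ℚ) :* a := con 0ℚ) refl (h 0) ⟩
      0ℚ                       ∎))
      where open Telescope refl k

    -- Among σ, 2 σ, ..., M σ = s n only the last is a multiple of s n. If C (n + 1) were zero at 0,
    -- then x = 0 and `h` would be constant up to M - 1; since it returns to its initial value at M,
    -- also D n (s n) = D n 0 would be zero.
    nonzero : ∀ n → n ≡ N → Structure s n D → C n (+ 0) ≢ 0ℚ
    nonzero zero    refl _   C≡0 = contradiction (trans (sym (Base.C₀-< refl 0 σ>0)) C≡0) λ ()
    nonzero (suc n) refl str C≡0 = Structure.nonzero str n refl (begin
      D n (+ 0)                  ≡⟨ IH.periods n n<N (+ 0) ⟨
      D n (+ s n)                ≡⟨ cong (λ i → D n (+ i)) (trans (cong (ℕ._* σ) 1+M∸1) Mσ≡sn) ⟨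
      d                          ≡⟨ solve 2 (λ h d → d := (h :+ (d :+ con 0ℚ)) :+ con (- 1ℚ) :* h) refl (h (ℕ.pred M)) d ⟩
      (h (ℕ.pred M) + (d + 0ℚ)) + - 1ℚ * h (ℕ.pred M)
                                 ≡⟨ cong₂ (λ y z → (h (ℕ.pred M) + (d + y)) + - 1ℚ * z) (sym x≡0) h-pred ⟩
      (h (ℕ.pred M) + (d + x)) + - 1ℚ * h 0
                                 ≡⟨ cong (_+ - 1ℚ * h 0) (trans (sym (h-step (ℕ.pred M))) (trans (cong h 1+M∸1) hM≡h0)) ⟩
      h 0 + - 1ℚ * h 0           ≡⟨ solve 1 (λ a → a :+ con (- 1ℚ) :* a := con 0ℚ) refl (h 0) ⟩
      0ℚ                         ∎)
      where
      open Telescope refl 0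
      instance _ = ℕ.>-nonZero M>0
      1+M∸1 : suc (ℕ.pred M) ≡ M
      1+M∸1 = ℕₚ.suc-pred M
      d = D n (+ (suc (ℕ.pred M) ℕ.* σ))
      x≡0 : x ≡ 0ℚ
      x≡0 = trans (cong (λ y → fromℕ (suc n) * (fromℤ (ℤ.- + σ) * y)) C≡0)
        (solve 2 (λ a b → a :* (b :* con 0ℚ) := con 0ℚ) refl (fromℕ (suc n)) (fromℤ (ℤ.- + σ)))
      h-pred : h (ℕ.pred M) ≡ h 0
      h-pred = trans (drift (ℕ.pred M) λ i i<M-1 → Structure.support str n refl _
          (>⇒∤ {{ℕ.>-nonZero (ℕₚ.≤-trans σ>0 (ℕₚ.m≤m+n σ (i ℕ.* σ)))}}
            (subst (suc i ℕ.* σ <_) Mσ≡sn (ℕₚ.*-monoˡ-< σ {{ℕ.>-nonZero σ>0}} (subst (suc i <_) 1+M∸1 (s≤s i<M-1))))))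
        (trans (cong (λ y → h 0 + fromℕ (ℕ.pred M) * y) x≡0) (solve 2 (λ a b → a :+ b :* con 0ℚ := a) refl (h 0) (fromℕ (ℕ.pred M))))

    indecomposable : ∀ j → j < suc N → ∀ p m g u → 0 < p → p < s j → 0 < m → m < s j →
                     (suc j < suc N → s (suc j) ∣ m) → IsPeriod g p → IsPeriod u m →
                     (∀ k → C j k ≡ g k + u k) → ⊥
    indecomposable j j≤N p m g u p>0 p<s m>0 m<s ∣m g-per u-per C≡ with ℕₚ.m<1+n⇒m<n∨m≡n j≤N
    -- Below the top, the carry is moved into the second summand: it comes from coefficients whose
    -- periods divide s (j + 1), and hence m.
    ... | inj₁ j<N = IH.indecomposable j j<N p m (backward-difference σ g)
        (λ k → backward-difference σ u k + - 1ℚ * carry (ℤ.- + σ) N′ C j k)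
        p>0 p<s m>0 m<s (λ _ → ∣m (s≤s j<N)) (bd-per p g-per)
        (Subspace.+∈ (IsPeriod-subspace m) (bd-per m u-per) (Subspace.*∈ (IsPeriod-subspace m) (- 1ℚ)
          (carry∈ (IsPeriod-subspace m) (ℤ.- + σ) N′ C j λ i j<i → IsPeriod-∣ {C i}
            (∣-trans (s∣s (ℕₚ.⊓-glb j<i j<N) (ℕₚ.m⊓n≤n i N)) (∣m (s≤s j<N))) (W i))))
        λ k → begin
          D j k
            ≡⟨ solve 2 (λ d r → d := (d :+ r) :+ con (- 1ℚ) :* r) refl (D j k) (carry (ℤ.- + σ) N′ C j k) ⟩
          (D j k + carry (ℤ.- + σ) N′ C j k) + - 1ℚ * carry (ℤ.- + σ) N′ C j k
            ≡⟨ cong (_+ - 1ℚ * carry (ℤ.- + σ) N′ C j k) (difference-expand σ N′ C j k) ⟨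
          (C j k + - 1ℚ * C j (k ℤ.+ ℤ.- + σ)) + - 1ℚ * carry (ℤ.- + σ) N′ C j k
            ≡⟨ cong₂ (λ x y → (x + - 1ℚ * y) + - 1ℚ * carry (ℤ.- + σ) N′ C j k) (C≡ k) (C≡ _) ⟩
          (g k + u k + - 1ℚ * (g (k ℤ.+ ℤ.- + σ) + u (k ℤ.+ ℤ.- + σ))) + - 1ℚ * carry (ℤ.- + σ) N′ C j k
            ≡⟨ solve 5 (λ g u g′ u′ r → (g :+ u :+ con (- 1ℚ) :* (g′ :+ u′)) :+ con (- 1ℚ) :* r
                 := (g :+ con (- 1ℚ) :* g′) :+ ((u :+ con (- 1ℚ) :* u′) :+ con (- 1ℚ) :* r)) refl
                 (g k) (u k) (g (k ℤ.+ ℤ.- + σ)) (u (k ℤ.+ ℤ.- + σ)) (carry (ℤ.- + σ) N′ C j k) ⟩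
          backward-difference σ g k + (backward-difference σ u k + - 1ℚ * carry (ℤ.- + σ) N′ C j k) ∎
      where
      bd-per : ∀ {c} q → IsPeriod c q → IsPeriod (backward-difference σ c) q
      bd-per q per = +∈ per (*∈ (- 1ℚ) (shift∈ (ℤ.- + σ) per))
        where open Subspace (IsPeriod-subspace q)
    ... | inj₂ refl = C0≢0 C0≡0
      where
      C0≢0 = nonzero N refl IH
      s∤ : ∀ q → 0 < q → q < σ → C N (+ q) ≡ 0ℚ
      s∤ q q>0 q<σ = support N refl IH q (>⇒∤ {{ℕ.>-nonZero q>0}} q<σ)
      -- With C = g + u, the mixed difference with steps p and m vanishes.
      sum≡0 : C N (+ 0) + C N (+ (p ℕ.+ m)) ≡ 0ℚ
      sum≡0 = begin
        C N (+ 0) + C N (+ (p ℕ.+ m))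
          ≡⟨ cong₂ _+_ (C≡ (+ 0)) (C≡ (+ (p ℕ.+ m))) ⟩
        (g (+ 0) + u (+ 0)) + (g (+ (p ℕ.+ m)) + u (+ (p ℕ.+ m)))
          ≡⟨ cong₂ (λ x y → (x + y) + (g (+ (p ℕ.+ m)) + u (+ (p ℕ.+ m)))) (sym (g-per (+ 0))) (sym (u-per (+ 0))) ⟩
        (g (+ p) + u (+ m)) + (g (+ (p ℕ.+ m)) + u (+ (p ℕ.+ m)))
          ≡⟨ cong₂ (λ x y → (g (+ p) + u (+ m)) + (x + y))
               (trans (cong (λ i → g (+ i)) (ℕₚ.+-comm p m)) (g-per (+ m))) (u-per (+ p)) ⟩
        (g (+ p) + u (+ m)) + (g (+ m) + u (+ p))
          ≡⟨ solve 4 (λ a b c d → (a :+ b) :+ (c :+ d) := (a :+ d) :+ (c :+ b)) refl (g (+ p)) (u (+ m)) (g (+ m)) (u (+ p)) ⟩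
        (g (+ p) + u (+ p)) + (g (+ m) + u (+ m))
          ≡⟨ cong₂ _+_ (trans (sym (C≡ (+ p))) (s∤ p p>0 p<s)) (trans (sym (C≡ (+ m))) (s∤ m m>0 m<s)) ⟩
        0ℚ ∎
      C0≡0 : C N (+ 0) ≡ 0ℚ
      -- Depending on whether σ divides p + m, the value at p + m equals the value at 0 or is zero,
      -- so the sum is two times or one times C N 0.
      C0≡0 with σ ∣? p ℕ.+ m
      ... | no σ∤ = trans (sym (ℚₚ.+-identityʳ _)) (trans (cong (λ y → C N (+ 0) + y) (sym (support N refl IH _ σ∤))) sum≡0)
      ... | yes σ∣ = x*y≡0⇒y≡0 (fromℕ≢0 {2} (s≤s z≤n)) (begin
        fromℕ 2 * C N (+ 0)              ≡⟨ solve 1 (λ x → con (fromℕ 2) :* x := x :+ x) refl (C N (+ 0)) ⟩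
        C N (+ 0) + C N (+ 0)            ≡⟨ cong (λ y → C N (+ 0) + y) (IsPeriod-∣ {C N} σ∣ (σ-period N ℕₚ.≤-refl) (+ 0)) ⟨
        C N (+ 0) + C N (+ (p ℕ.+ m))    ≡⟨ sum≡0 ⟩
        0ℚ                               ∎)

  structure-suc : Structure s (suc N) C
  structure-suc = record
    { vanishes       = vanish
    ; periods        = λ j j≤N → subst (λ i → IsPeriod (C j) (s i)) (ℕₚ.m≤n⇒m⊓n≡m (ℕₚ.≤-pred j≤N)) (W j)
    ; support        = λ { n refl → support N refl IH }
    ; nonzero        = λ { n refl → nonzero N refl IH }
    ; indecomposable = indecomposable
    }

structure : ∀ s N → (∀ i → i < N → 0 < s i) → (∀ i → suc i < N → s (suc i) ∣ s i) →
            ∀ {N′ C P K f} → Represents N′ C P K f → HasDenominator (applyDownFrom s N) f → Structure s N C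
structure s zero    pos div r den = record
  { vanishes       = λ j _ → unit-vanishes r den j
  ; periods        = λ j ()
  ; support        = λ n ()
  ; nonzero        = λ n ()
  ; indecomposable = λ j ()
  }
structure s (suc N) pos div r den = StructureStep.structure-suc s N pos div r den
  (structure s N (λ i i<N → pos i (ℕₚ.m<n⇒m<1+n i<N)) (λ i i<N → div i (ℕₚ.m<n⇒m<1+n i<N)) (Represents-∇ (s N) r) den)

-- Lattice points of dilated simplices

module _ {A : Set} where

  HasCardinality-unique : ∀ {P : Pred A 0ℓ} {M N} → HasCardinality P M → HasCardinality P N → M ≡ N
  HasCardinality-unique (xs , xs! , ∈xs⇔ , refl) (ys , ys! , ∈ys⇔ , refl) =
    ↭-length (∼bag⇒↭ (unique∧set⇒bag xs! ys! λ {x} → ⇔-trans (∈xs⇔ x) (⇔-sym (∈ys⇔ x))))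

  HasCardinality-⇔ : ∀ {P Q : Pred A 0ℓ} {N} → (∀ x → P x ⇔ Q x) → HasCardinality P N → HasCardinality Q N
  HasCardinality-⇔ P⇔Q (xs , xs! , ∈xs⇔ , len) = xs , xs! , (λ x → ⇔-trans (∈xs⇔ x) (P⇔Q x)) , len

  HasCardinality-∪ : ∀ {P Q : Pred A 0ℓ} {M N} → Empty (P ∩ Q) →
                     HasCardinality P M → HasCardinality Q N → HasCardinality (P ∪ Q) (M ℕ.+ N)
  HasCardinality-∪ disjoint (xs , xs! , ∈xs⇔ , refl) (ys , ys! , ∈ys⇔ , refl) =
    xs ++ ys ,
    Uniqueₚ.++⁺ xs! ys! (λ {x} (x∈xs , x∈ys) → disjoint x (to (∈xs⇔ x) x∈xs , to (∈ys⇔ x) x∈ys)) ,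
    (λ x → mk⇔ (λ x∈ → Sum.map (to (∈xs⇔ x)) (to (∈ys⇔ x)) (∈-++⁻ xs x∈))
               (λ { (inj₁ Px) → ∈-++⁺ˡ (from′ (∈xs⇔ x) Px) ; (inj₂ Qx) → ∈-++⁺ʳ xs (from′ (∈ys⇔ x) Qx) })) ,
    Listₚ.length-++ xs
    where open Equivalence renaming (from to from′)

Image : ∀ {A B : Set} → (A → B) → Pred A 0ℓ → Pred B 0ℓ
Image f P y = ∃[ x ] P x × y ≡ f x

HasCardinality-Image : ∀ {A B : Set} {P : Pred A 0ℓ} {N} (f : A → B) → (∀ {x y} → f x ≡ f y → x ≡ y) →
                       HasCardinality P N → HasCardinality (Image f P) N
HasCardinality-Image f f-inj (xs , xs! , ∈xs⇔ , refl) =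
  map f xs , Uniqueₚ.map⁺ f-inj xs! ,
  (λ y → mk⇔ (λ y∈ → let x , x∈ , y≡ = ∈-map⁻ f y∈ in x , Equivalence.to (∈xs⇔ x) x∈ , y≡)
             (λ { (x , Px , refl) → ∈-map⁺ f (Equivalence.from (∈xs⇔ x) Px) })) ,
  Listₚ.length-map f xs

weigh : ∀ {n} → (Fin n → ℕ) → Vec ℕ n → ℕ
weigh α []       = 0
weigh α (x ∷ xs) = α zero ℕ.* x ℕ.+ weigh (α ∘ suc) xs

Solution : ∀ {n} → (Fin n → ℕ) → ℕ → Pred (Vec ℕ n) 0ℓ
Solution α k x = weigh α x ≡ k

bump : ∀ {n} → Vec ℕ (suc n) → Vec ℕ (suc n)
bump (x ∷ xs) = suc x ∷ xs

bump-injective : ∀ {n} {x y : Vec ℕ (suc n)} → bump x ≡ bump y → x ≡ y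
bump-injective {x = x ∷ xs} {y ∷ ys} refl = refl

weigh-0∷ : ∀ {n} (α : Fin (suc n) → ℕ) xs → weigh α (0 ∷ xs) ≡ weigh (α ∘ suc) xs
weigh-0∷ α xs = cong (ℕ._+ weigh (α ∘ suc) xs) (ℕₚ.*-zeroʳ (α zero))

weigh-bump : ∀ {n} (α : Fin (suc n) → ℕ) x → weigh α (bump x) ≡ α zero ℕ.+ weigh α x
weigh-bump α (x ∷ xs) = trans (cong (ℕ._+ weigh (α ∘ suc) xs) (ℕₚ.*-suc (α zero) x)) (ℕₚ.+-assoc (α zero) _ _)

solutions-[] : ∀ (α : Fin 0 → ℕ) k → ∃[ N ] HasCardinality (Solution α k) N × fromℕ N ≡ unit k
solutions-[] α zero    = 1 , ([] ∷ [] , [] ∷ [] , (λ { [] → mk⇔ (λ _ → refl) (λ _ → here refl) }) , refl) , refl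
solutions-[] α (suc k) = 0 , ([] , [] , (λ { [] → mk⇔ (λ ()) (λ ()) }) , refl) , refl

solutions-< : ∀ {n N} (α : Fin (suc n) → ℕ) k → k < α zero →
              HasCardinality (Solution (α ∘ suc) k) N → HasCardinality (Solution α k) N
solutions-< α k k<α₀ sols = HasCardinality-⇔
  (λ x → mk⇔ (λ { (xs , eq , refl) → trans (weigh-0∷ α xs) eq }) (to x))
  (HasCardinality-Image (0 ∷_) Vecₚ.∷-injectiveʳ sols)
  where
  to : ∀ x → Solution α k x → Image (0 ∷_) (Solution (α ∘ suc) k) x
  to (zero  ∷ xs) eq = xs , trans (sym (weigh-0∷ α xs)) eq , refl
  to (suc x ∷ xs) eq = contradiction
    (ℕₚ.≤-trans (ℕₚ.m≤m+n (α zero) _) (ℕₚ.≤-reflexive (trans (sym (weigh-bump α (x ∷ xs))) eq))) (ℕₚ.<⇒≱ k<α₀)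

-- Split by whether the first coordinate is zero or can be lowered by one. This is the recursion f k
-- = f⁺ k + f (k - α₀) that the factor 1 / (1 - z ^ α₀) encodes.
solutions-+ : ∀ {n M N} (α : Fin (suc n) → ℕ) k →
              HasCardinality (Solution (α ∘ suc) (α zero ℕ.+ k)) M → HasCardinality (Solution α k) N →
              HasCardinality (Solution α (α zero ℕ.+ k)) (M ℕ.+ N)
solutions-+ α k sols₀ sols₊ = HasCardinality-⇔
  (λ x → mk⇔ (λ { (inj₁ (xs , eq , refl)) → trans (weigh-0∷ α xs) eq
                ; (inj₂ (y , eq , refl)) → trans (weigh-bump α y) (cong (λ i → α zero ℕ.+ i) eq) }) (to x))
  (HasCardinality-∪ disjoint (HasCardinality-Image (0 ∷_) Vecₚ.∷-injectiveʳ sols₀)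
    (HasCardinality-Image bump bump-injective sols₊))
  where
  P = Image (0 ∷_) (Solution (α ∘ suc) (α zero ℕ.+ k))
  Q = Image bump (Solution α k)
  disjoint : Empty (P ∩ Q)
  disjoint _ ((_ , _ , refl) , ((_ ∷ _) , _ , ()))
  to : ∀ x → Solution α (α zero ℕ.+ k) x → (P ∪ Q) x
  to (zero  ∷ xs) eq = inj₁ (xs , trans (sym (weigh-0∷ α xs)) eq , refl)
  to (suc x ∷ xs) eq = inj₂ ((x ∷ xs) , ℕₚ.+-cancelˡ-≡ (α zero) _ _ (trans (sym (weigh-bump α (x ∷ xs))) eq) , refl)

abstract
  solutions : ∀ {n} (α : Fin n → ℕ) → (∀ i → NonZero (α i)) → ∀ k → ∃[ N ] HasCardinality (Solution α k) N
  solutions {zero}  α _   k = let N , sols , _ = solutions-[] α k in N , sols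
  solutions {suc n} α α≢0 = <-rec _ go
    where
    go : ∀ k → (∀ {j} → j < k → ∃[ N ] HasCardinality (Solution α j) N) → ∃[ N ] HasCardinality (Solution α k) N
    go k rec with ℕₚ.<-≤-connex k (α zero)
    ... | inj₁ k<α₀ = let N , sols = solutions (α ∘ suc) (α≢0 ∘ suc) k in N , solutions-< α k k<α₀ sols
    ... | inj₂ α₀≤k with j , refl ← ℕₚ.m≤n⇒∃[o]m+o≡n α₀≤k =
      let M , sols₀ = solutions (α ∘ suc) (α≢0 ∘ suc) k
          N , sols₊ = rec (ℕₚ.m<n+m j (ℕ.>-nonZero⁻¹ (α zero) {{α≢0 zero}}))
      in M ℕ.+ N , solutions-+ α j sols₀ sols₊

count : ∀ {n} (α : Fin n → ℕ) → (∀ i → NonZero (α i)) → ℕ → ℕ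
count α α≢0 k = proj₁ (solutions α α≢0 k)

count-denominator : ∀ {n} (α : Fin n → ℕ) (α≢0 : ∀ i → NonZero (α i)) →
                    HasDenominator (tabulate α) (fromℕ ∘ count α α≢0)
count-denominator {zero}  α α≢0 k = let N , sols , N≡unit = solutions-[] α k in
  trans (cong fromℕ (HasCardinality-unique (proj₂ (solutions α α≢0 k)) sols)) N≡unit
count-denominator {suc n} α α≢0 = HasDenominator-cong (tabulate (α ∘ suc)) (sym ∘ ∇-count)
  (count-denominator (α ∘ suc) (α≢0 ∘ suc))
  where
  open ≡-Reasoning
  f = fromℕ ∘ count α α≢0
  f⁺ = fromℕ ∘ count (α ∘ suc) (α≢0 ∘ suc)
  ∇-count : ∀ k → ∇ (α zero) f k ≡ f⁺ k
  ∇-count k with ℕₚ.<-≤-connex k (α zero)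
  ... | inj₁ k<α₀ = begin
    f k + - 1ℚ * delay (α zero) f k    ≡⟨ cong₂ (λ x y → fromℕ x + - 1ℚ * y)
      (HasCardinality-unique (proj₂ (solutions α α≢0 k)) (solutions-< α k k<α₀ (proj₂ (solutions (α ∘ suc) (α≢0 ∘ suc) k))))
      (delay-< (α zero) f k k<α₀) ⟩
    f⁺ k + - 1ℚ * 0ℚ                   ≡⟨ ℚₚ.+-identityʳ (f⁺ k) ⟩
    f⁺ k                               ∎
  ... | inj₂ α₀≤k with j , refl ← ℕₚ.m≤n⇒∃[o]m+o≡n α₀≤k = begin
    ∇ (α zero) f (α zero ℕ.+ j)        ≡⟨ ∇-+ (α zero) f j ⟩
    f k + - 1ℚ * f j                   ≡⟨ cong (λ x → fromℕ x + - 1ℚ * f j) (HasCardinality-unique (proj₂ (solutions α α≢0 k))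
      (solutions-+ α j (proj₂ (solutions (α ∘ suc) (α≢0 ∘ suc) k)) (proj₂ (solutions α α≢0 j)))) ⟩
    fromℕ (count (α ∘ suc) (α≢0 ∘ suc) k ℕ.+ count α α≢0 j) + - 1ℚ * f j
                                       ≡⟨ cong (_+ - 1ℚ * f j) (fromℕ-+ (count (α ∘ suc) (α≢0 ∘ suc) k) (count α α≢0 j)) ⟩
    f⁺ k + f j + - 1ℚ * f j            ≡⟨ solve 2 (λ a b → a :+ b :+ con (- 1ℚ) :* b := a) refl (f⁺ k) (f j) ⟩
    f⁺ k                               ∎

fromℕ-inverseʳ : ∀ n .{{_ : NonZero n}} → fromℕ n * (+ 1 ℚ./ n) ≡ 1ℚ
fromℕ-inverseʳ n@(suc n-1) = ℚₚ.toℚᵘ-injective (begin-equality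
  toℚᵘ (fromℕ n * (+ 1 ℚ./ n))            ≃⟨ ℚₚ.toℚᵘ-homo-* (fromℕ n) (+ 1 ℚ./ n) ⟩
  toℚᵘ (fromℕ n) ℚᵘ.* toℚᵘ (+ 1 ℚ./ n)    ≃⟨ ℚᵘₚ.*-cong (toℚᵘ-fromℤ (+ n)) (ℚₚ.toℚᵘ-fromℚᵘ (ℚᵘ.mkℚᵘ (+ 1) n-1)) ⟩
  ℚᵘ.mkℚᵘ (+ n) 0 ℚᵘ.* ℚᵘ.mkℚᵘ (+ 1) n-1  ≃⟨ ℚᵘₚ.*-inverseʳ (ℚᵘ.mkℚᵘ (+ n) 0) ⟩
  ℚᵘ.1ℚᵘ                                  ∎)
  where open ℚᵘₚ.≤-Reasoning

fromℤ-cancel-0≤ : ∀ {k} → 0ℚ ℚ.≤ fromℤ k → + 0 ℤ.≤ k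
fromℤ-cancel-0≤ {k} 0≤k = subst (+ 0 ℤ.≤_) (ℤₚ.*-identityʳ k) (ℚᵘₚ.drop-*≤*
  (ℚᵘₚ.≤-respʳ-≃ (toℚᵘ-fromℤ k) (ℚₚ.toℚᵘ-mono-≤ 0≤k)))

0≤+/ : ∀ m n .{{_ : NonZero n}} → 0ℚ ℚ.≤ (+ m ℚ./ n)
0≤+/ m n = ℚₚ.nonNegative⁻¹ (+ m ℚ./ n) {{ℚₚ.normalize-nonNeg m n}}

0≤* : ∀ {x y} → 0ℚ ℚ.≤ x → 0ℚ ℚ.≤ y → 0ℚ ℚ.≤ x * y
0≤* {x} {y} 0≤x 0≤y =
  ℚₚ.nonNegative⁻¹ (x * y) {{ℚₚ.nonNeg*nonNeg⇒nonNeg x {{ℚ.nonNegative 0≤x}} y {{ℚ.nonNegative 0≤y}}}}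

sum-zero : ∀ {n} (f : Fin n → ℚ) → (∀ i → f i ≡ 0ℚ) → sum f ≡ 0ℚ
sum-zero {zero}  f f≡0 = refl
sum-zero {suc n} f f≡0 = cong₂ _+_ (f≡0 zero) (sum-zero (f ∘ suc) (f≡0 ∘ suc))

sum-single : ∀ {n} (f : Fin n → ℚ) l → (∀ i → i ≢ l → f i ≡ 0ℚ) → sum f ≡ f l
sum-single f zero    f≡0 = trans (cong (λ y → f zero + y) (sum-zero (f ∘ suc) (λ i → f≡0 (suc i) λ ()))) (ℚₚ.+-identityʳ _)
sum-single f (suc l) f≡0 = trans (cong₂ _+_ (f≡0 zero λ ()) (sum-single (f ∘ suc) l (λ i i≢l → f≡0 (suc i) (i≢l ∘ Finₚ.suc-injective))))
  (ℚₚ.+-identityˡ _)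

fromℕ-weigh : ∀ {n} (α : Fin n → ℕ) x → sum (λ l → fromℕ (α l) * fromℕ (lookup x l)) ≡ fromℕ (weigh α x)
fromℕ-weigh α []       = refl
fromℕ-weigh α (x ∷ xs) = begin
  fromℕ (α zero) * fromℕ x + sum (λ l → fromℕ (α (suc l)) * fromℕ (lookup xs l))
    ≡⟨ cong₂ _+_ (sym (fromℕ-* (α zero) x)) (fromℕ-weigh (α ∘ suc) xs) ⟩
  fromℕ (α zero ℕ.* x) + fromℕ (weigh (α ∘ suc) xs)
    ≡⟨ fromℕ-+ (α zero ℕ.* x) (weigh (α ∘ suc) xs) ⟨
  fromℕ (α zero ℕ.* x ℕ.+ weigh (α ∘ suc) xs) ∎
  where open ≡-Reasoning

module _ {n} (α : Fin n → ℕ) (α≢0 : ∀ i → NonZero (α i)) where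

  α⁻¹ : Fin n → ℚ
  α⁻¹ l = (+ 1 ℚ./ α l) {{α≢0 l}}

  α*α⁻¹ : ∀ l → fromℕ (α l) * α⁻¹ l ≡ 1ℚ
  α*α⁻¹ l = fromℕ-inverseʳ (α l) {{α≢0 l}}

  combination-axisPoint : ∀ (w : Fin n → ℚ) l → sum (λ i → w i * axisPoint α α≢0 i l) ≡ w l * α⁻¹ l
  combination-axisPoint w l = trans (sum-single _ l off) (cong (w l *_) diagonal)
    where
    diagonal : axisPoint α α≢0 l l ≡ α⁻¹ l
    diagonal rewrite dec-true (l Finₚ.≟ l) refl = refl
    off : ∀ i → i ≢ l → w i * axisPoint α α≢0 i l ≡ 0ℚ
    off i i≢l rewrite dec-false (i Finₚ.≟ l) i≢l = ℚₚ.*-zeroʳ (w i)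

  -- In the dilate by k, coordinate l equals k times the l-th weight divided by α l. Hence α l times
  -- the coordinate is k times the weight, and weights of sum 1 amount to a weighted coordinate sum
  -- of k.
  LatticePoint⇒Solution : ∀ k z → LatticePoint (dilate k (Simplex α α≢0)) z → Image (Vec.map (+_)) (Solution α k) z
  LatticePoint⇒Solution k z (p , hull , z≡kp) = x , fromℕ-injective (begin
    fromℕ (weigh α x)                                   ≡⟨ fromℕ-weigh α x ⟨
    sum (λ l → fromℕ (α l) * fromℕ (lookup x l))        ≡⟨ sum-cong-≗ (λ l → cong (λ i → fromℕ (α l) * fromℤ i) (x≡z l)) ⟩
    sum (λ l → fromℕ (α l) * fromℤ (lookup z l))        ≡⟨ sum-cong-≗ αz ⟩
    sum (λ l → fromℕ k * weight l)                      ≡⟨ *-distribˡ-sum (fromℕ k) weight ⟨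
    fromℕ k * sum weight                                ≡⟨ cong (fromℕ k *_) sumsToOne ⟩
    fromℕ k * 1ℚ                                        ≡⟨ ℚₚ.*-identityʳ (fromℕ k) ⟩
    fromℕ k                                             ∎) , z≡x
    where
    open ConvexHull hull
    open ≡-Reasoning
    fromℕ-injective : ∀ {i j} → fromℕ i ≡ fromℕ j → i ≡ j
    fromℕ-injective eq = ℤₚ.+-injective (fromℤ-injective eq)
    x = Vec.map ℤ.∣_∣ z
    αz : ∀ l → fromℕ (α l) * fromℤ (lookup z l) ≡ fromℕ k * weight l
    αz l = begin
      fromℕ (α l) * fromℤ (lookup z l)
        ≡⟨ cong (fromℕ (α l) *_) (trans (z≡kp l) (cong (fromℕ k *_) (trans (combination l) (combination-axisPoint weight l)))) ⟩
      fromℕ (α l) * (fromℕ k * (weight l * α⁻¹ l))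
        ≡⟨ solve 4 (λ a k w b → a :* (k :* (w :* b)) := k :* w :* (a :* b)) refl (fromℕ (α l)) (fromℕ k) (weight l) (α⁻¹ l) ⟩
      fromℕ k * weight l * (fromℕ (α l) * α⁻¹ l)
        ≡⟨ trans (cong (fromℕ k * weight l *_) (α*α⁻¹ l)) (ℚₚ.*-identityʳ _) ⟩
      fromℕ k * weight l ∎
    0≤z : ∀ l → + 0 ℤ.≤ lookup z l
    0≤z l = fromℤ-cancel-0≤ (subst (0ℚ ℚ.≤_)
      (sym (trans (z≡kp l) (cong (fromℕ k *_) (trans (combination l) (combination-axisPoint weight l)))))
      (0≤* (0≤+/ k 1) (0≤* (nonNegative l) (0≤+/ 1 (α l) {{α≢0 l}}))))
    x≡z : ∀ l → + lookup x l ≡ lookup z l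
    x≡z l = trans (cong (+_) (Vecₚ.lookup-map l ℤ.∣_∣ z)) (ℤₚ.0≤i⇒+∣i∣≡i (0≤z l))
    z≡x : z ≡ Vec.map (+_) x
    z≡x = trans (sym (Vecₚ.tabulate∘lookup z)) (trans
      (Vecₚ.tabulate-cong λ l → trans (sym (x≡z l)) (sym (Vecₚ.lookup-map l (+_) x)))
      (Vecₚ.tabulate∘lookup (Vec.map (+_) x)))

  Solution⇒LatticePoint : ∀ k → NonZero k → ∀ z → Image (Vec.map (+_)) (Solution α k) z →
                          LatticePoint (dilate k (Simplex α α≢0)) z
  Solution⇒LatticePoint k k≢0 _ (x , eq , refl) = (λ l → fromℕ (lookup x l) * k⁻¹) , record
    -- The barycentric weights are forced: α l times the l-th coordinate, divided by k.
    { weight      = λ l → fromℕ (α l) * fromℕ (lookup x l) * k⁻¹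
    ; nonNegative = λ l → 0≤* (0≤* (0≤+/ (α l) 1) (0≤+/ (lookup x l) 1)) (0≤+/ 1 k {{k≢0}})
    ; sumsToOne   = begin
        sum (λ l → fromℕ (α l) * fromℕ (lookup x l) * k⁻¹)  ≡⟨ *-distribʳ-sum k⁻¹ (λ l → fromℕ (α l) * fromℕ (lookup x l)) ⟨
        sum (λ l → fromℕ (α l) * fromℕ (lookup x l)) * k⁻¹  ≡⟨ cong (_* k⁻¹) (trans (fromℕ-weigh α x) (cong fromℕ eq)) ⟩
        fromℕ k * k⁻¹                                       ≡⟨ k*k⁻¹ ⟩
        1ℚ                                                  ∎
    ; combination = λ l → sym (begin
        sum (λ i → fromℕ (α i) * fromℕ (lookup x i) * k⁻¹ * axisPoint α α≢0 i l)
          ≡⟨ combination-axisPoint (λ l → fromℕ (α l) * fromℕ (lookup x l) * k⁻¹) l ⟩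
        fromℕ (α l) * fromℕ (lookup x l) * k⁻¹ * α⁻¹ l
          ≡⟨ solve 4 (λ a x k b → a :* x :* k :* b := x :* k :* (a :* b)) refl (fromℕ (α l)) (fromℕ (lookup x l)) k⁻¹ (α⁻¹ l) ⟩
        fromℕ (lookup x l) * k⁻¹ * (fromℕ (α l) * α⁻¹ l)
          ≡⟨ trans (cong (fromℕ (lookup x l) * k⁻¹ *_) (α*α⁻¹ l)) (ℚₚ.*-identityʳ _) ⟩
        fromℕ (lookup x l) * k⁻¹ ∎)
    } , λ l → begin
        fromℤ (lookup (Vec.map (+_) x) l)        ≡⟨ cong fromℤ (Vecₚ.lookup-map l (+_) x) ⟩
        fromℕ (lookup x l)                     ≡⟨ trans (cong (fromℕ (lookup x l) *_) k*k⁻¹) (ℚₚ.*-identityʳ _) ⟨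
        fromℕ (lookup x l) * (fromℕ k * k⁻¹)   ≡⟨ solve 3 (λ x k j → x :* (k :* j) := k :* (x :* j)) refl (fromℕ (lookup x l)) (fromℕ k) k⁻¹ ⟩
        fromℕ k * (fromℕ (lookup x l) * k⁻¹)   ∎
    where
    open ≡-Reasoning
    k⁻¹ = (+ 1 ℚ./ k) {{k≢0}}
    k*k⁻¹ : fromℕ k * k⁻¹ ≡ 1ℚ
    k*k⁻¹ = fromℕ-inverseʳ k {{k≢0}}

  map-+-injective : ∀ {n} {x y : Vec ℕ n} → Vec.map (+_) x ≡ Vec.map (+_) y → x ≡ y
  map-+-injective {x = []}     {[]}     _  = refl
  map-+-injective {x = x ∷ xs} {y ∷ ys} eq = cong₂ _∷_ (ℤₚ.+-injective (Vecₚ.∷-injectiveˡ eq)) (map-+-injective (Vecₚ.∷-injectiveʳ eq))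

  Ehrhart-count : ∀ {d} (q : QuasiPolynomial d) → IsEhrhart (Simplex α α≢0) q →
                  ∀ k → NonZero k → eval q (+ k) ≡ fromℕ (count α α≢0 k)
  Ehrhart-count q ehrhart k k≢0 with N , points , q≡N ← ehrhart k k≢0 = trans q≡N (cong fromℕ (HasCardinality-unique points
    (HasCardinality-⇔ (λ z → mk⇔ (Solution⇒LatticePoint k k≢0 z) (LatticePoint⇒Solution k z))
      (HasCardinality-Image (Vec.map (+_)) map-+-injective (proj₂ (solutions α α≢0 k))))))

-- Quasi-polynomials as sequences, and convolution

-- The default is the zero function for coefficients, which keeps the value of the quasi-polynomial,
-- and 1 for denominators, which keeps them positive.
extend : ∀ {A : Set} {n} → A → (Fin n → A) → ℕ → A
extend {n = zero}  x f j       = x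
extend {n = suc n} x f zero    = f zero
extend {n = suc n} x f (suc j) = extend x (f ∘ suc) j

extend-toℕ : ∀ {A : Set} {n} (x : A) (f : Fin n → A) i → extend x f (toℕ i) ≡ f i
extend-toℕ x f zero    = refl
extend-toℕ x f (suc i) = extend-toℕ x (f ∘ suc) i

extend-≥ : ∀ {A : Set} {n} (x : A) (f : Fin n → A) j → n ≤ j → extend x f j ≡ x
extend-≥ {n = zero}  x f j       _         = refl
extend-≥ {n = suc n} x f (suc j) (s≤s n≤j) = extend-≥ x (f ∘ suc) j n≤j

extend-∀ : ∀ {A : Set} {n} (P : A → Set) {x : A} {f : Fin n → A} → P x → (∀ i → P (f i)) → ∀ j → P (extend x f j)
extend-∀ {n = zero}  P Px Pf j       = Px
extend-∀ {n = suc n} P Px Pf zero    = Pf zero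
extend-∀ {n = suc n} P Px Pf (suc j) = extend-∀ P Px (Pf ∘ suc) j

tabulate-extend : ∀ {A : Set} {n} (x : A) (f : Fin n → A) → tabulate f ≡ applyUpTo (extend x f) n
tabulate-extend {n = zero}  x f = refl
tabulate-extend {n = suc n} x f = cong (f zero ∷_) (tabulate-extend x (f ∘ suc))

pad : ∀ {n} → (Fin n → ℤ → ℚ) → Coeffs
pad = extend (λ _ → 0ℚ)

ev-pad : ∀ {n} (c : Fin n → ℤ → ℚ) k → sum (λ j → c j k * fromℤ (k ℤ.^ toℕ j)) ≡ ev n (pad c) k
ev-pad {zero}  c k = refl
ev-pad {suc n} c k = cong₂ _+_ (ℚₚ.*-identityʳ (c zero k)) (begin
  sum (λ j → c (suc j) k * fromℤ (k ℤ.* k ℤ.^ toℕ j))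
    ≡⟨ sum-cong-≗ (λ j → trans (cong (c (suc j) k *_) (fromℤ-* k (k ℤ.^ toℕ j)))
         (solve 3 (λ c k p → c :* (k :* p) := k :* (c :* p)) refl (c (suc j) k) (fromℤ k) (fromℤ (k ℤ.^ toℕ j)))) ⟩
  sum (λ j → fromℤ k * (c (suc j) k * fromℤ (k ℤ.^ toℕ j)))
    ≡⟨ *-distribˡ-sum (fromℤ k) (λ j → c (suc j) k * fromℤ (k ℤ.^ toℕ j)) ⟨
  fromℤ k * sum (λ j → c (suc j) k * fromℤ (k ℤ.^ toℕ j))
    ≡⟨ cong (fromℤ k *_) (ev-pad (c ∘ suc) k) ⟩
  fromℤ k * ev n (pad (c ∘ suc)) k ∎)
  where open ≡-Reasoning

common-period : ∀ {n} (c : Fin n → ℤ → ℚ) → (∀ j → Periodic (c j)) → ∃[ P ] 0 < P × (∀ j → IsPeriod (c j) P)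
common-period {zero}  c per = 1 , s≤s z≤n , λ ()
common-period {suc n} c per with per zero | common-period (c ∘ suc) (per ∘ suc)
... | p , p≢0 , p-per | P , P>0 , P-per = p ℕ.* P , ℕₚ.*-mono-≤ (ℕ.>-nonZero⁻¹ p {{p≢0}}) P>0 , λ
  { zero    → IsPeriod-∣ {c zero} (m∣m*n P) p-per
  ; (suc j) → IsPeriod-∣ {c (suc j)} (n∣m*n p) (P-per j) }

represents : ∀ {d} (q : QuasiPolynomial d) K {f} → (∀ k → K ≤ k → eval q (+ k) ≡ f k) →
             ∃[ P ] Represents (suc d) (pad (coeff q)) P K f
represents {d} q K q≡f with P , P>0 , P-per ← common-period (coeff q) (periodic q) = P , record
  { bounded    = λ j d<j k → cong (λ c → c k) (extend-≥ (λ _ → 0ℚ) (coeff q) j d<j)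
  ; P>0        = P>0
  ; period     = extend-∀ (λ c → IsPeriod c P) (λ _ → refl) P-per
  ; eventually = λ k K≤k → trans (sym (ev-pad (coeff q) (+ k))) (q≡f k K≤k)
  }

-- A period p < s j would give the forbidden decomposition of C j as itself plus zero. The zero
-- function has every period, so m may be s (j + 1), smaller than s j by strictness of the chain, or
-- p itself when j is the top index.
Structure-minimum-period : ∀ {s N C} → (∀ i → i < N → 0 < s i) → (∀ i → suc i < N → s (suc i) < s i) →
                           Structure s N C → ∀ j → j < N → ∀ {p} → IsMinPeriod (C j) p → p ≡ s j
Structure-minimum-period {s} {N} {C} pos s< str j j<N {p} min =
  ℕₚ.≤-antisym (minimal (s j) (ℕ.>-nonZero (pos j j<N)) (periods j j<N)) (ℕₚ.≮⇒≥ λ p<s → p≮s p<s (ℕₚ.<-≤-connex (suc j) N))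
  where
  open IsMinPeriod min
  open Structure str
  p>0 : 0 < p
  p>0 = ℕ.>-nonZero⁻¹ p {{positive}}
  split : p < s j → ∀ m → 0 < m → m < s j → (suc j < N → s (suc j) ∣ m) → ⊥
  split p<s m m>0 m<s ∣m = indecomposable j j<N p m (C j) (λ _ → 0ℚ) p>0 p<s m>0 m<s ∣m isPeriod (λ _ → refl)
    λ k → sym (ℚₚ.+-identityʳ (C j k))
  p≮s : p < s j → suc j < N ⊎ N ≤ suc j → ⊥
  p≮s p<s (inj₁ 1+j<N) = split p<s (s (suc j)) (pos _ 1+j<N) (s< _ 1+j<N) (λ _ → ∣-refl)
  p≮s p<s (inj₂ N≤1+j) = split p<s p p>0 p<s (λ 1+j<N → contradiction N≤1+j (ℕₚ.<⇒≱ 1+j<N))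

minimum-period : ∀ s N → (∀ i → i < N → 0 < s i) → (∀ i → suc i < N → s (suc i) ∣ s i) →
                 (∀ i → suc i < N → s (suc i) < s i) →
                 ∀ {d f} (q : QuasiPolynomial d) → (∀ k → eval q (+ k) ≡ f k) →
                 HasDenominator (applyDownFrom s N) f →
                 ∀ j → toℕ j < N → ∀ {p} → IsMinPeriod (coeff q j) p → p ≡ s (toℕ j)
minimum-period s N pos div s< q q≡f den j j<N {p} min =
  Structure-minimum-period pos s< (structure s N pos div (proj₂ (represents q 0 (λ k _ → q≡f k))) den) (toℕ j) j<N
    (subst (λ c → IsMinPeriod c p) (sym (extend-toℕ _ (coeff q) j)) min)

conv : (ℕ → ℚ) → (ℕ → ℚ) → ℕ → ℚ
conv f g k = ∑[ m ≤ k ] (f (k ℕ.∸ toℕ m) * g (toℕ m))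

conv-cong : ∀ {f f′ g g′} → (∀ k → f k ≡ f′ k) → (∀ k → g k ≡ g′ k) → ∀ k → conv f g k ≡ conv f′ g′ k
conv-cong f≡ g≡ k = sum-cong-≗ {suc k} λ m → cong₂ _*_ (f≡ (k ℕ.∸ toℕ m)) (g≡ (toℕ m))

convolution-conv : ∀ A B k → convolution A B k ≡ conv (A ∘ +_) (B ∘ +_) k
convolution-conv A B k = sum-cong-≗ {suc k} λ m → cong (λ i → A i * B (+ toℕ m))
  (trans (ℤₚ.m-n≡m⊖n k (toℕ m)) (ℤₚ.⊖-≥ (ℕₚ.≤-pred (Finₚ.toℕ<n m))))

conv-+* : ∀ f f′ g x k → conv (λ k → f k + x * f′ k) g k ≡ conv f g k + x * conv f′ g k
conv-+* f f′ g x zero = solve 4 (λ a b c x → (a :+ x :* b) :* c :+ con 0ℚ := a :* c :+ con 0ℚ :+ x :* (b :* c :+ con 0ℚ)) refl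
  (f 0) (f′ 0) (g 0) x
conv-+* f f′ g x (suc k) = trans
  (cong (λ y → (f (suc k) + x * f′ (suc k)) * g 0 + y) (conv-+* f f′ (g ∘ suc) x k))
  (solve 6 (λ a b c x u v → (a :+ x :* b) :* c :+ (u :+ x :* v) := a :* c :+ u :+ x :* (b :* c :+ v)) refl
    (f (suc k)) (f′ (suc k)) (g 0) x (conv f (g ∘ suc) k) (conv f′ (g ∘ suc) k))

conv-delay₁ : ∀ f g k → conv (delay 1 f) g k ≡ delay 1 (conv f g) k
conv-delay₁ f g zero    = solve 1 (λ x → con 0ℚ :* x :+ con 0ℚ := con 0ℚ) refl (g 0)
conv-delay₁ f g (suc k) = trans (cong (λ y → f k * g 0 + y) (conv-delay₁ f (g ∘ suc) k)) (go k)
  where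
  go : ∀ k → f k * g 0 + delay 1 (conv f (g ∘ suc)) k ≡ conv f g k
  go zero    = refl
  go (suc k) = refl

conv-delay : ∀ s f g k → conv (delay s f) g k ≡ delay s (conv f g) k
conv-delay zero    f g k = refl
conv-delay (suc s) f g k = begin
  conv (delay (suc s) f) g k       ≡⟨ conv-cong {g = g} (λ k → sym (delay-delay 1 s f k)) (λ _ → refl) k ⟩
  conv (delay 1 (delay s f)) g k   ≡⟨ conv-delay₁ (delay s f) g k ⟩
  delay 1 (conv (delay s f) g) k   ≡⟨ delay-cong 1 (conv-delay s f g) k ⟩
  delay 1 (delay s (conv f g)) k   ≡⟨ delay-delay 1 s (conv f g) k ⟩
  delay (suc s) (conv f g) k       ∎
  where open ≡-Reasoning

conv-∇ : ∀ s f g k → conv (∇ s f) g k ≡ ∇ s (conv f g) k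
conv-∇ s f g k = trans (conv-+* f (delay s f) g (- 1ℚ) k) (cong (λ y → conv f g k + - 1ℚ * y) (conv-delay s f g k))

conv-unit : ∀ g k → conv unit g k ≡ g k
conv-unit g zero    = solve 1 (λ x → con 1ℚ :* x :+ con 0ℚ := x) refl (g 0)
conv-unit g (suc k) = trans (cong (λ y → 0ℚ * g 0 + y) (conv-unit (g ∘ suc) k))
  (solve 2 (λ x y → con 0ℚ :* x :+ y := y) refl (g 0) (g (suc k)))

-- Convolution multiplies generating functions: clearing the denominators of f one by one turns f
-- into `unit`, the neutral element, and leaves g.
conv-denominator : ∀ ss ts {f g} → HasDenominator ss f → HasDenominator ts g → HasDenominator (ss ++ ts) (conv f g)
conv-denominator []       ts {f} {g} f-den g-den = HasDenominator-cong ts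
  (λ k → trans (sym (conv-unit g k)) (conv-cong {g = g} (λ k → sym (f-den k)) (λ _ → refl) k)) g-den
conv-denominator (s ∷ ss) ts {f} {g} f-den g-den = HasDenominator-cong (ss ++ ts) (conv-∇ s f g)
  (conv-denominator ss ts f-den g-den)

-- The Ehrhart property covers k ≥ 1. The value at 0, which enters the first and last terms of the
-- convolution, is supplied by `agreement`, as there is at least one factor.
eval-count : ∀ {d} (α : Fin (suc d) → ℕ) (α≢0 : ∀ i → NonZero (α i)) (q : QuasiPolynomial d) →
             IsEhrhart (Simplex α α≢0) q → ∀ k → eval q (+ k) ≡ fromℕ (count α α≢0 k)
eval-count α α≢0 q ehrhart k = trans (ev-pad (coeff q) (+ k)) (agreement (α zero) (tabulate (α ∘ suc))
  (Allₚ.tabulate⁺ {f = α} λ i → ℕ.>-nonZero⁻¹ (α i) {{α≢0 i}})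
  (proj₂ (represents q 1 λ k k>0 → Ehrhart-count α α≢0 q ehrhart k (ℕ.>-nonZero k>0)))
  (count-denominator α α≢0) k)

applyDownFrom-↭ : ∀ {A : Set} (f : ℕ → A) n → applyUpTo f n ↭ applyDownFrom f n
applyDownFrom-↭ f n = subst (applyUpTo f n ↭_) (Listₚ.reverse-applyUpTo f n) (Perm.↭-sym (↭-reverse (applyUpTo f n)))

-- The merged chain

-- b 0, a 0, b 1, a 1, …, b (m - 1), a (m - 1), a m, a (m + 1), …
interleave : ℕ → (ℕ → ℕ) → (ℕ → ℕ) → ℕ → ℕ
interleave zero    a b J             = a J
interleave (suc m) a b zero          = b 0
interleave (suc m) a b (suc zero)    = a 0
interleave (suc m) a b (suc (suc J)) = interleave m (a ∘ suc) (b ∘ suc) J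

interleave-∀ : ∀ (P : ℕ → Set) m {a b} → (∀ i → P (a i)) → (∀ i → P (b i)) → ∀ J → P (interleave m a b J)
interleave-∀ P zero    Pa Pb J             = Pa J
interleave-∀ P (suc m) Pa Pb zero          = Pb 0
interleave-∀ P (suc m) Pa Pb (suc zero)    = Pa 0
interleave-∀ P (suc m) Pa Pb (suc (suc J)) = interleave-∀ P m (Pa ∘ suc) (Pb ∘ suc) J

-- The last hypothesis begins at i = m - 1 in order to cover the junction between the alternating
-- part and the tail of a's.
interleave-linked : ∀ (R : ℕ → ℕ → Set) m n {a b} → m ≤ n →
                    (∀ i → i < m → R (b i) (a i)) →
                    (∀ i → suc i < m → R (a i) (b (suc i))) →
                    (∀ i → m ≤ suc i → suc i < n → R (a i) (a (suc i))) →
                    ∀ J → suc J < m ℕ.+ n → R (interleave m a b J) (interleave m a b (suc J))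
interleave-linked R zero          n       _         ba ab aa J             J<   = aa J z≤n J<
interleave-linked R (suc m)       n       _         ba ab aa zero          J<   = ba 0 (s≤s z≤n)
interleave-linked R (suc zero)    n       _         ba ab aa (suc zero)    (s≤s J<) = aa 0 ℕₚ.≤-refl J<
interleave-linked R (suc (suc m)) n       _         ba ab aa (suc zero)    J<   = ab 0 (s≤s (s≤s z≤n))
interleave-linked R (suc m)       (suc n) (s≤s m≤n) ba ab aa (suc (suc J)) (s≤s J<) =
  interleave-linked R m n m≤n (λ i i<m → ba (suc i) (s≤s i<m)) (λ i i<m → ab (suc i) (s≤s i<m))
    (λ i m≤i i<n → aa (suc i) (s≤s m≤i) (s≤s i<n)) J (ℕₚ.≤-pred (subst (suc (suc J) <_) (ℕₚ.+-suc m n) J<))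

interleave-↭ : ∀ m n a b → m ≤ n → applyUpTo (interleave m a b) (m ℕ.+ n) ↭ applyUpTo a n ++ applyUpTo b m
interleave-↭ zero    n       a b _         = Perm.↭-reflexive (sym (Listₚ.++-identityʳ (applyUpTo a n)))
interleave-↭ (suc m) (suc n) a b (s≤s m≤n) rewrite ℕₚ.+-suc m n = Perm.↭-trans
  (Perm.swap (b 0) (a 0) (interleave-↭ m n (a ∘ suc) (b ∘ suc) m≤n))
  (Perm.prep (a 0) (Perm.↭-sym (shift (b 0) (applyUpTo (a ∘ suc) n) (applyUpTo (b ∘ suc) m))))

interleave-b : ∀ m a b {l} → l < m → interleave m a b (l ℕ.+ l) ≡ b l
interleave-b (suc m) a b {zero}  _         = refl
interleave-b (suc m) a b {suc l} (s≤s l<m) rewrite ℕₚ.+-suc l l = interleave-b m (a ∘ suc) (b ∘ suc) l<m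

-- In the alternating part a i stands at 2 i + 1, in the tail at m + i; the minimum selects the
-- valid expression in both ranges.
interleave-a : ∀ m a b i → interleave m a b (suc (i ℕ.+ i) ℕ.⊓ (m ℕ.+ i)) ≡ a i
interleave-a zero    a b i       = cong a (ℕₚ.m≥n⇒m⊓n≡n (ℕₚ.m≤n⇒m≤1+n (ℕₚ.m≤m+n i i)))
interleave-a (suc m) a b zero    = refl
interleave-a (suc m) a b (suc i) rewrite ℕₚ.+-suc i i | ℕₚ.+-suc m i = interleave-a m (a ∘ suc) (b ∘ suc) i

-- Least common multiples of lists and the numbers g_j.

∈⇒∣lcmList : ∀ {x xs} → x ∈ xs → x ∣ lcmList xs
∈⇒∣lcmList {x} {_ ∷ xs} (here refl) = m∣lcm[m,n] x (lcmList xs)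
∈⇒∣lcmList {x} {y ∷ xs} (there x∈)  = ∣-trans (∈⇒∣lcmList x∈) (n∣lcm[m,n] y (lcmList xs))

lcmList-least : ∀ {m} xs → (∀ {x} → x ∈ xs → x ∣ m) → lcmList xs ∣ m
lcmList-least {m} []       xs∣m = 1∣ m
lcmList-least     (x ∷ xs) xs∣m = lcm-least (xs∣m (here refl)) (lcmList-least xs (xs∣m ∘ there))

∈-from⁺ : ∀ {d} J (f : Fin (suc d) → ℕ) i → J ≤ toℕ i → f i ∈ from J f
∈-from⁺ J f i J≤i = ∈-map⁺ f (∈-filter⁺ (λ i → J ℕₚ.≤? toℕ i) (∈-allFin i) J≤i)

∈-from⁻ : ∀ {d} J (f : Fin (suc d) → ℕ) {x} → x ∈ from J f → ∃[ i ] J ≤ toℕ i × x ≡ f i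
∈-from⁻ {d} J f x∈ with i , i∈ , refl ← ∈-map⁻ f x∈ =
  i , proj₂ (∈-filter⁻ (λ i → J ℕₚ.≤? toℕ i) {xs = allFin (suc d)} i∈) , refl

gcd∣gShifted : ∀ {d e} (α̂ : Fin (suc d) → ℕ) (β̂ : Fin (suc e) → ℕ) i l →
               gcd (α̂ i) (β̂ l) ∣ gShifted α̂ β̂ (suc (toℕ i ℕ.+ toℕ l))
gcd∣gShifted α̂ β̂ i l = ∈⇒∣lcmList (∈-map⁺ (λ (i , l) → gcd (α̂ i) (β̂ l))
  (∈-filter⁺ (λ (i′ , l′) → toℕ i′ ℕ.+ toℕ l′ ℕₚ.≟ toℕ i ℕ.+ toℕ l) (∈-cartesianProduct⁺ (∈-allFin i) (∈-allFin l)) refl))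

gShifted-least : ∀ {d e} (α̂ : Fin (suc d) → ℕ) (β̂ : Fin (suc e) → ℕ) j {m} →
                 (∀ i l → toℕ i ℕ.+ toℕ l ≡ j → gcd (α̂ i) (β̂ l) ∣ m) → gShifted α̂ β̂ (suc j) ∣ m
gShifted-least {d} {e} α̂ β̂ j gcd∣m = lcmList-least _ λ x∈ → go (∈-map⁻ (λ (i , l) → gcd (α̂ i) (β̂ l)) x∈)
  where
  pairs = cartesianProduct (allFin (suc d)) (allFin (suc e))
  go : ∀ {x} → ∃[ il ] il ∈ filter (λ (i , l) → toℕ i ℕ.+ toℕ l ℕₚ.≟ j) pairs × x ≡ gcd (α̂ (proj₁ il)) (β̂ (proj₂ il)) → x ∣ _
  go ((i , l) , il∈ , refl) = gcd∣m i l (proj₂ (∈-filter⁻ (λ (i , l) → toℕ i ℕ.+ toℕ l ℕₚ.≟ j) {xs = pairs} il∈))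

halves : ∀ j → ∃[ i ] ∃[ l ] i ℕ.+ l ≡ j × i ≤ l × l ≤ suc i
halves zero    = 0 , 0 , refl , z≤n , z≤n
halves (suc j) with i , l , eq , i≤l , l≤1+i ← halves j =
  l , suc i , trans (ℕₚ.+-suc l i) (cong suc (trans (ℕₚ.+-comm l i) eq)) , l≤1+i , s≤s i≤l

-- The last two bounds concern the positions of α_i and β_l in the merged chain: neither comes after
-- j + 1, so the term at j + 1 divides both. Nearly equal halves of j do this. If the larger half
-- exceeds e, then l = e is taken instead, and α_(j - e) is at position j + 1 in the tail.
balanced-split : ∀ {d e} → e ≤ d → ∀ j → j ≤ d ℕ.+ e →
                 ∃[ i ] ∃[ l ] i ℕ.+ l ≡ j × i ≤ d × l ≤ e × suc (i ℕ.+ i) ℕ.⊓ (suc e ℕ.+ i) ≤ suc j × l ℕ.+ l ≤ suc j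
balanced-split {d} {e} e≤d j j≤d+e with halves j
... | i , l , refl , i≤l , l≤1+i with ℕₚ.<-≤-connex e l
...   | inj₂ l≤e = i , l , refl , ℕₚ.≤-trans i≤l (ℕₚ.≤-trans l≤e e≤d) , l≤e ,
        ℕₚ.≤-trans (ℕₚ.m⊓n≤m _ (suc e ℕ.+ i)) (s≤s (ℕₚ.+-monoʳ-≤ i i≤l)) , ℕₚ.+-monoˡ-≤ l l≤1+i
...   | inj₁ e<l = j ℕ.∸ e , e , ℕₚ.m∸n+n≡m e≤j , i≤d , ℕₚ.≤-refl ,
        ℕₚ.≤-trans (ℕₚ.m⊓n≤n (suc (j ℕ.∸ e ℕ.+ (j ℕ.∸ e))) _) (s≤s (ℕₚ.≤-reflexive (ℕₚ.m+[n∸m]≡n e≤j))) ,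
        ℕₚ.≤-trans (ℕₚ.+-mono-≤ (ℕₚ.≤-pred (ℕₚ.≤-trans e<l l≤1+i)) (ℕₚ.<⇒≤ e<l)) (ℕₚ.n≤1+n j)
  where
  e≤j : e ≤ j
  e≤j = ℕₚ.≤-trans (ℕₚ.<⇒≤ e<l) (ℕₚ.m≤n+m l i)
  i≤d : j ℕ.∸ e ≤ d
  i≤d = ℕₚ.≤-trans (ℕₚ.∸-monoˡ-≤ e j≤d+e) (ℕₚ.≤-reflexive (ℕₚ.m+n∸n≡m d e))

infix 4 _▷_
_▷_ : ℕ → ℕ → Set
x ▷ y = y ∣ x × y < x

▷-trans : ∀ {x y z} → x ▷ y → y ▷ z → x ▷ z
▷-trans (y∣x , y<x) (z∣y , z<y) = ∣-trans z∣y y∣x , ℕₚ.<-trans z<y y<x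

Ehrhart-minimum-period : ∀ {n} (δ : Fin (suc n) → ℕ) (δ≢0 : ∀ i → NonZero (δ i)) →
  (∀ i → suc i < suc n → extend 1 δ i ▷ extend 1 δ (suc i)) →
  ∀ (q : QuasiPolynomial n) → IsEhrhart (Simplex δ δ≢0) q → ∀ i {p} → IsMinPeriod (coeff q i) p → p ≡ δ i
Ehrhart-minimum-period {n} δ δ≢0 δ-chain q ehrhart i min = trans
  (minimum-period (extend 1 δ) (suc n)
    (λ i _ → extend-∀ (0 <_) (s≤s z≤n) (λ i → ℕ.>-nonZero⁻¹ (δ i) {{δ≢0 i}}) i)
    (λ i i<n → proj₁ (δ-chain i i<n)) (λ i i<n → proj₂ (δ-chain i i<n))
    q (eval-count δ δ≢0 q ehrhart)
    (HasDenominator-↭ (fromℕ ∘ count δ δ≢0) (subst (_↭ applyDownFrom (extend 1 δ) (suc n)) (sym (tabulate-extend 1 δ))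
      (applyDownFrom-↭ (extend 1 δ) (suc n))) (count-denominator δ δ≢0))
    i (Finₚ.toℕ<n i) min)
  (extend-toℕ 1 δ i)

-- The divisibility chain of the theorem and its lcm formula.

module Chain (d e : ℕ) (e≤d : e ≤ d) (α : Fin (suc d) → ℕ) (β : Fin (suc e) → ℕ)
         (α≢0 : ∀ i → NonZero (α i)) (β≢0 : ∀ l → NonZero (β l))
         (distinct : Distinct α β) (chain : DivisibilityChain α β) where

  open Distinct distinct
  open DivisibilityChain chain
  a = extend 1 α
  b = extend 1 β
  s = interleave (suc e) a b
  N = suc e ℕ.+ suc d

  a>0 : ∀ i → 0 < a i
  a>0 = extend-∀ (0 <_) (s≤s z≤n) (λ i → ℕ.>-nonZero⁻¹ (α i) {{α≢0 i}})

  b>0 : ∀ l → 0 < b l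
  b>0 = extend-∀ (0 <_) (s≤s z≤n) (λ l → ℕ.>-nonZero⁻¹ (β l) {{β≢0 l}})

  s>0 : ∀ J → 0 < s J
  s>0 = interleave-∀ (0 <_) (suc e) a>0 b>0

  strict : ∀ {x y} → 0 < x → y ∣ x → y ≢ x → x ▷ y
  strict x>0 y∣x y≢x = y∣x , ℕₚ.≤∧≢⇒< (∣⇒≤ {{ℕ.>-nonZero x>0}} y∣x) y≢x

  a-α : ∀ {i} (i<n : i < suc d) → a i ≡ α (fromℕ< i<n)
  a-α {i} i<n = trans (cong a (sym (Finₚ.toℕ-fromℕ< i<n))) (extend-toℕ 1 α (fromℕ< i<n))

  b-β : ∀ {l} (l<m : l < suc e) → b l ≡ β (fromℕ< l<m)
  b-β {l} l<m = trans (cong b (sym (Finₚ.toℕ-fromℕ< l<m))) (extend-toℕ 1 β (fromℕ< l<m))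

  b▷a : ∀ i → i < suc e → b i ▷ a i
  b▷a i i<m = strict (b>0 i) (subst₂ _∣_ (sym (a-α i<n)) (sym (b-β i<m))
      (α∣β (fromℕ< i<n) (fromℕ< i<m) (trans (Finₚ.toℕ-fromℕ< i<n) (sym (Finₚ.toℕ-fromℕ< i<m)))))
    (subst₂ _≢_ (sym (a-α i<n)) (sym (b-β i<m)) (α≢β _ _))
    where
    i<n : i < suc d
    i<n = ℕₚ.≤-trans i<m (s≤s e≤d)

  a▷b : ∀ i → suc i < suc e → a i ▷ b (suc i)
  a▷b i 1+i<m = strict (a>0 i) (subst₂ _∣_ (sym (b-β 1+i<m)) (sym (a-α i<n))
      (β∣α (fromℕ< i<n) (fromℕ< 1+i<m) (trans (Finₚ.toℕ-fromℕ< 1+i<m) (cong suc (sym (Finₚ.toℕ-fromℕ< i<n))))))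
    (subst₂ _≢_ (sym (b-β 1+i<m)) (sym (a-α i<n)) (≢-sym (α≢β _ _)))
    where
    i<n : i < suc d
    i<n = ℕₚ.≤-trans (ℕₚ.<⇒≤ 1+i<m) (s≤s e≤d)

  a▷a : ∀ i → suc e ≤ suc i → suc i < suc d → a i ▷ a (suc i)
  a▷a i e≤i 1+i<n = strict (a>0 i) (subst₂ _∣_ (sym (a-α 1+i<n)) (sym (a-α i<n))
      (α∣α (fromℕ< i<n) (fromℕ< 1+i<n) (subst (e ≤_) (sym (Finₚ.toℕ-fromℕ< i<n)) (ℕₚ.≤-pred e≤i))
        (trans (Finₚ.toℕ-fromℕ< 1+i<n) (cong suc (sym (Finₚ.toℕ-fromℕ< i<n))))))
    (subst₂ _≢_ (sym (a-α 1+i<n)) (sym (a-α i<n)) λ eq → ℕₚ.1+n≢n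
      (trans (sym (Finₚ.toℕ-fromℕ< 1+i<n)) (trans (cong toℕ (α-injective eq)) (Finₚ.toℕ-fromℕ< i<n))))
    where
    i<n : i < suc d
    i<n = ℕₚ.<⇒≤ 1+i<n

  -- In the alternating range two consecutive α's are compared through the β between them. The α's
  -- and the β's must each form a strict chain for their own minimum periods to be read off.
  a-chain : ∀ i → suc i < suc d → a i ▷ a (suc i)
  a-chain i 1+i<n with ℕₚ.<-≤-connex (suc i) (suc e)
  ... | inj₁ 1+i<m = ▷-trans (a▷b i 1+i<m) (b▷a (suc i) 1+i<m)
  ... | inj₂ m≤1+i = a▷a i m≤1+i 1+i<n

  b-chain : ∀ l → suc l < suc e → b l ▷ b (suc l)
  b-chain l 1+l<m = ▷-trans (b▷a l (ℕₚ.<⇒≤ 1+l<m)) (a▷b l 1+l<m)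

  s-chain : ∀ J → suc J < N → s J ▷ s (suc J)
  s-chain = interleave-linked _▷_ (suc e) (suc d) (s≤s e≤d) b▷a a▷b a▷a

  s∣s : ∀ {I J} → J ≤ I → I < N → s I ∣ s J
  s∣s = chain-∣ {s} (λ J J<N → proj₁ (s-chain J J<N))

  α-at : ∀ i → s (suc (toℕ i ℕ.+ toℕ i) ℕ.⊓ (suc e ℕ.+ toℕ i)) ≡ α i
  α-at i = trans (interleave-a (suc e) a b (toℕ i)) (extend-toℕ 1 α i)

  β-at : ∀ l → s (toℕ l ℕ.+ toℕ l) ≡ β l
  β-at l = trans (interleave-b (suc e) a b (Finₚ.toℕ<n l)) (extend-toℕ 1 β l)

  α∣s : ∀ i {J} → J ≤ suc (toℕ i ℕ.+ toℕ i) ℕ.⊓ (suc e ℕ.+ toℕ i) → α i ∣ s J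
  α∣s i {J} J≤ = subst (_∣ s J) (α-at i) (s∣s J≤ (ℕₚ.≤-<-trans (ℕₚ.m⊓n≤n _ (suc e ℕ.+ toℕ i))
    (ℕₚ.+-monoʳ-< (suc e) (Finₚ.toℕ<n i))))

  β∣s : ∀ l {J} → J ≤ toℕ l ℕ.+ toℕ l → β l ∣ s J
  β∣s l {J} J≤ = subst (_∣ s J) (β-at l) (s∣s J≤ (ℕₚ.+-mono-< (Finₚ.toℕ<n l) (ℕₚ.≤-trans (Finₚ.toℕ<n l) (s≤s e≤d))))

  -- Every entry of the list divides a chain term at position J or later, hence s J. Conversely s 0
  -- is β₀, an entry of `from 0 β`, and for J = j + 1 the term s J divides the gcd given by
  -- `balanced-split`, one of those that make up g_j.
  periods-lcm : ∀ J → J < N → s J ≡ lcmList (from J α ++ from J β ++ gShifted α β J ∷ [])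
  periods-lcm J J<N = ∣-antisym (s∣lcm J J<N) (lcmList-least (from J α ++ from J β ++ gShifted α β J ∷ []) ∣s)
    where
    gcd∣s : ∀ i l → gcd (α i) (β l) ∣ s (suc (toℕ i ℕ.+ toℕ l))
    -- Whichever of α_i and β_l comes later in the merged chain stands at position i + l + 1 or
    -- beyond.
    gcd∣s i l with ℕₚ.<-≤-connex (toℕ i) (toℕ l)
    ... | inj₁ i<l = ∣-trans (gcd[m,n]∣n (α i) (β l)) (β∣s l (ℕₚ.+-monoˡ-≤ (toℕ l) i<l))
    ... | inj₂ l≤i = ∣-trans (gcd[m,n]∣m (α i) (β l)) (α∣s i (ℕₚ.⊓-glb (s≤s (ℕₚ.+-monoʳ-≤ (toℕ i) l≤i))
      (subst (_≤ suc e ℕ.+ toℕ i) (cong suc (ℕₚ.+-comm (toℕ l) (toℕ i))) (ℕₚ.+-monoˡ-≤ (toℕ i) (Finₚ.toℕ<n l)))))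

    g∣s : ∀ J → gShifted α β J ∣ s J
    g∣s zero    = 1∣ s 0
    g∣s (suc j) = gShifted-least α β j λ { i l refl → gcd∣s i l }

    ∣s : ∀ {x} → x ∈ from J α ++ from J β ++ gShifted α β J ∷ [] → x ∣ s J
    ∣s x∈ with ∈-++⁻ (from J α) x∈
    ... | inj₁ x∈α with i , J≤i , refl ← ∈-from⁻ J α x∈α =
      α∣s i (ℕₚ.≤-trans J≤i (ℕₚ.⊓-glb (ℕₚ.m≤n⇒m≤1+n (ℕₚ.m≤m+n _ _)) (ℕₚ.m≤n+m _ (suc e))))
    ... | inj₂ x∈′ with ∈-++⁻ (from J β) x∈′
    ...   | inj₁ x∈β with l , J≤l , refl ← ∈-from⁻ J β x∈β = β∣s l (ℕₚ.≤-trans J≤l (ℕₚ.m≤m+n _ _))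
    ...   | inj₂ (here refl) = g∣s J

    s∣lcm : ∀ J → J < N → s J ∣ lcmList (from J α ++ from J β ++ gShifted α β J ∷ [])
    s∣lcm zero    _ = ∈⇒∣lcmList (∈-++⁺ʳ (from 0 α) (∈-++⁺ˡ (∈-from⁺ 0 β zero z≤n)))
    s∣lcm (suc j) J<N with balanced-split e≤d j (ℕₚ.≤-pred (ℕₚ.≤-pred (subst (suc j <_) (cong suc (trans (ℕₚ.+-suc e d) (cong suc (ℕₚ.+-comm e d)))) J<N)))
    ... | i , l , refl , i≤d , l≤e , i-early , l-early = ∣-trans (gcd-greatest s∣α s∣β)
        (∣-trans (subst₂ (λ i l → gcd (α i′) (β l′) ∣ gShifted α β (suc (i ℕ.+ l))) i′≡i l′≡l (gcd∣gShifted α β i′ l′))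
          (∈⇒∣lcmList (∈-++⁺ʳ (from (suc j) α) (∈-++⁺ʳ (from (suc j) β) (here refl)))))
      where
      i′ = fromℕ< (s≤s i≤d)
      l′ = fromℕ< (s≤s l≤e)
      i′≡i : toℕ i′ ≡ i
      i′≡i = Finₚ.toℕ-fromℕ< (s≤s i≤d)
      l′≡l : toℕ l′ ≡ l
      l′≡l = Finₚ.toℕ-fromℕ< (s≤s l≤e)
      s∣α : s (suc (i ℕ.+ l)) ∣ α i′
      s∣α = subst (s (suc (i ℕ.+ l)) ∣_) (α-at i′) (s∣s (subst (λ i → suc (i ℕ.+ i) ℕ.⊓ (suc e ℕ.+ i) ≤ suc j) (sym i′≡i) i-early) J<N)
      s∣β : s (suc (i ℕ.+ l)) ∣ β l′
      s∣β = subst (s (suc (i ℕ.+ l)) ∣_) (β-at l′) (s∣s (subst (λ l → l ℕ.+ l ≤ suc j) (sym l′≡l) l-early) J<N)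

  tabulate-↭ : tabulate α ++ tabulate β ↭ applyDownFrom s N
  tabulate-↭ = Perm.↭-trans
    (Perm.↭-reflexive (cong₂ _++_ (tabulate-extend 1 α) (tabulate-extend 1 β)))
    (Perm.↭-trans (Perm.↭-sym (interleave-↭ (suc e) (suc d) a b (s≤s e≤d))) (applyDownFrom-↭ s N))

theorem7 : (d e : ℕ) → e ≤ d →
    (α : Fin (suc d) → ℕ) (β : Fin (suc e) → ℕ)
    (α≢0 : ∀ i → NonZero (α i)) (β≢0 : ∀ l → NonZero (β l)) →
    Distinct α β →
    DivisibilityChain α β →
    (a : QuasiPolynomial d) → IsEhrhart (Simplex α α≢0) a →
    (b : QuasiPolynomial e) → IsEhrhart (Simplex β β≢0) b →
    (α̂ : Fin (suc d) → ℕ) → (∀ i → IsMinPeriod (coeff a i) (α̂ i)) →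
    (β̂ : Fin (suc e) → ℕ) → (∀ l → IsMinPeriod (coeff b l) (β̂ l)) →
    (c : QuasiPolynomial (suc (d ℕ.+ e))) → IsConvolution a b c →
    (γ : Fin (suc (suc (d ℕ.+ e))) → ℕ) → (∀ J → IsMinPeriod (coeff c J) (γ J)) →
    -- J plays the role of j + 1, for -1 ≤ j ≤ d + e
    (J : Fin (suc (suc (d ℕ.+ e)))) →
    γ J ≡ lcmList (from (toℕ J) α̂ ++ from (toℕ J) β̂ ++ gShifted α̂ β̂ (toℕ J) ∷ [])
theorem7 d e e≤d α β α≢0 β≢0 distinct chain q q-ehrhart r r-ehrhart α̂ α̂-min β̂ β̂-min c c-conv γ γ-min J = begin
  γ J
    ≡⟨ minimum-period s N (λ J _ → s>0 J) (λ J J<N → proj₁ (s-chain J J<N)) (λ J J<N → proj₂ (s-chain J J<N)) c c≡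
         (HasDenominator-↭ (conv f g) tabulate-↭ (conv-denominator (tabulate α) (tabulate β) {f} {g}
           (count-denominator α α≢0) (count-denominator β β≢0)))
         J J<N (γ-min J) ⟩
  s (toℕ J)
    ≡⟨ periods-lcm (toℕ J) J<N ⟩
  lcmList (from (toℕ J) α ++ from (toℕ J) β ++ gShifted α β (toℕ J) ∷ [])
    ≡⟨ cong lcmList (cong₂ _++_ (from-cong (toℕ J) (sym ∘ α̂≡α)) (cong₂ _++_ (from-cong (toℕ J) (sym ∘ β̂≡β)) (cong (_∷ []) (gShifted-cong (toℕ J))))) ⟩
  lcmList (from (toℕ J) α̂ ++ from (toℕ J) β̂ ++ gShifted α̂ β̂ (toℕ J) ∷ []) ∎
  where
  open ≡-Reasoning
  open Chain d e e≤d α β α≢0 β≢0 distinct chain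
  J<N : toℕ J < N
  J<N = subst (toℕ J <_) (cong suc (sym (trans (ℕₚ.+-suc e d) (cong suc (ℕₚ.+-comm e d))))) (Finₚ.toℕ<n J)
  α̂≡α : ∀ i → α̂ i ≡ α i
  α̂≡α i = Ehrhart-minimum-period α α≢0 a-chain q q-ehrhart i (α̂-min i)
  β̂≡β : ∀ l → β̂ l ≡ β l
  β̂≡β l = Ehrhart-minimum-period β β≢0 b-chain r r-ehrhart l (β̂-min l)
  f = fromℕ ∘ count α α≢0
  g = fromℕ ∘ count β β≢0
  c≡ : ∀ k → eval c (+ k) ≡ conv f g k
  c≡ k = trans (c-conv k) (trans (convolution-conv (eval q) (eval r) k)
    (conv-cong (eval-count α α≢0 q q-ehrhart) (eval-count β β≢0 r r-ehrhart) k))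
  from-cong : ∀ {n} {f g : Fin (suc n) → ℕ} J → (∀ i → f i ≡ g i) → from J f ≡ from J g
  from-cong {n} J f≡g = Listₚ.map-cong f≡g (filter (λ i → J ℕₚ.≤? toℕ i) (allFin (suc n)))
  gShifted-cong : ∀ J → gShifted α β J ≡ gShifted α̂ β̂ J
  gShifted-cong zero    = refl
  gShifted-cong (suc j) = cong lcmList (Listₚ.map-cong (λ (i , l) → cong₂ gcd (sym (α̂≡α i)) (sym (β̂≡β l)))
    (filter (λ (i , l) → toℕ i ℕ.+ toℕ l ℕₚ.≟ j) (cartesianProduct (allFin (suc d)) (allFin (suc e)))))
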